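{- There is a parameter-preserving reduction from Co-Path Set (CPS) to Bipartite One-sided Vertex Explosion (BOVE). Additionally, there is a parameter-preserving reduction from restricted CPS to restricted BOVE. In all four problems the parameter is $k$.
   Context: Graphs are finite, undirected and simple. Vertex explosion: exploding a vertex $v$ of a graph removes $v$ and, for each former neighbor $u$ of $v$, adds a new vertex adjacent only to $u$. Exploding every vertex of a set $S$ means exploding the vertices of $S$ one after another (the order does not matter up to isomorphism). A path decomposition of $G$ is a sequence $X_1,\ldots,X_s$ of vertex sets such that every vertex lies in some $X_i$, both endpoints of every edge lie in some common $X_i$, and $X_i\cap X_j\subseteq X_l$ for all $i\le l\le j$; its width is $\max_i|X_i|-1$, and the pathwidth of $G$ is the minimum width of a path decomposition of $G$. A graph is a linear forest if every connected component is a path (a single vertex is a path). BOVE: the input is a bipartite graph $G=(T,B,E)$ (with its bipartition $T,B$) and an integer $k\ge 0$; the question is whether there is $S\subseteq B$ with $|S|\le k$ such that exploding every vertex in $S$ results in a graph with pathwidth at most one. Restricted BOVE: the input additionally contains a set $X\subseteq B$, and $S$ is required to be a subset of $X$. CPS: the input is a graph $G$ and an integer $k\ge 0$; the question is whether there is $S\subseteq E(G)$ with $|S|\le k$ such that deleting the edges in $S$ (keeping all vertices) results in a linear forest. Restricted CPS: the input additionally contains a set $X\subseteq E(G)$, and $S$ is required to be a subset of $X$. A parameter-preserving reduction from a parameterized problem $P$ to a parameterized problem $Q$ is a polynomial-time algorithm that maps each instance $(I,k)$ of $P$ to an instance $(I',k')$ of $Q$ such that $k'\le k$ and $(I,k)$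 is a yes-instance of $P$ if and only if $(I',k')$ is a yes-instance of $Q$. -}

module Defs where

open import Data.Bool.Base using (Bool; true; false; T; not; _∧_)
open import Data.Empty using (⊥)
open import Data.Fin.Base using (Fin; zero; suc; toℕ)
import Data.Fin.Base as Fin
import Data.Fin.Properties as Fin
open import Data.Fin.Subset using (Subset; _⊆_; ∣_∣)
open import Data.Fin.Subset.Properties using (_∈?_)
open import Data.Integer.Base as ℤ using (ℤ; +_; _⊖_)
open import Data.List.Base as List
  using (List; []; _∷_; _++_; length; filter; filterᵇ; allFin; cartesianProduct;
         concatMap; replicate; tabulate; drop)
open import Data.List.Extrema.Nat using (max)
open import Data.List.Membership.Propositional using (_∈_)
open import Data.List.Membership.Propositional.Properties using (∈-lookup)
open import Data.List.Relation.Unary.All as All using ()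
open import Data.List.Relation.Unary.AllPairs using (_∷_)
open import Data.List.Relation.Unary.Unique.Propositional using (Unique)
import Data.List.Relation.Unary.Unique.Propositional.Properties as Unique
open import Data.Nat.Base using (ℕ; zero; suc; _+_; _*_; _^_; _≤_)
open import Data.Nat.Binary.Base using (ℕᵇ; zero; 2[1+_]; 1+[2_]; fromℕ)
open import Data.Product.Base using (Σ; _×_; _,_; proj₂; ∃-syntax)
open import Data.Sum.Base using (_⊎_; inj₁; inj₂)
open import Data.Sum.Properties using (inj₂-injective)
open import Data.Vec.Base as Vec using (Vec; lookup; updateAt)
open import Function.Base using (_∘_)
open import Function.Bundles using (_⇔_)
open import Function.Definitions using (Injective)
open import Relation.Binary.Construct.Closure.ReflexiveTransitive using (Star)
open import Relation.Binary.PropositionalEquality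
  using (_≡_; _≢_; refl; sym; cong; cong₂; subst)
open import Relation.Nullary using (¬_; does; contradiction)

------------------------------------------------------------------------
-- Simple graphs

-- The vertex type is arbitrary because exploding a vertex changes it.
-- Every graph occurring in the four problems below is finite: it is
-- obtained from a graph on Fin n, or on Fin t ⊎ Fin b, by deleting edges
-- or exploding vertices.
record Graph : Set₁ where
  field
    V       : Set
    _~_     : V → V → Set
    ~-sym   : ∀ {u v} → u ~ v → v ~ u
    ~-irrefl : ∀ {v} → ¬ (v ~ v)

open Graph public using (V)

module _ (G : Graph) where
  open Graph G using (_~_)

  -- A finite set of vertices is a list without repetitions, so that its
  -- cardinality is its length.
  record PathDecomposition : Set where
    field
      s           : ℕ
      X           : Fin s → List (V G)
      unique      : ∀ i → Unique (X i)
      coverVertex : ∀ v → ∃[ i ] v ∈ X i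
      coverEdge   : ∀ {u v} → u ~ v → ∃[ i ] (u ∈ X i × v ∈ X i)
      convex      : ∀ {i l j v} → i Fin.≤ l → l Fin.≤ j →
                    v ∈ X i → v ∈ X j → v ∈ X l

    width : ℤ
    width = max 0 (tabulate (length ∘ X)) ⊖ 1

  -- The pathwidth, i.e. the minimum width, is at most w.
  PathwidthAtMost : ℤ → Set
  PathwidthAtMost w = Σ PathDecomposition λ D → PathDecomposition.width D ℤ.≤ w

  Consecutive : ∀ {m} → Fin m → Fin m → Set
  Consecutive i j = toℕ j ≡ suc (toℕ i) ⊎ toℕ i ≡ suc (toℕ j)

  -- The component of v, i.e. the subgraph induced by the vertices
  -- reachable from v, is the path p 0, …, p (m-1).  Here m ≥ 1, since v is
  -- reachable from itself.
  ComponentIsPath : V G → Set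
  ComponentIsPath v =
    ∃[ m ] Σ (Fin m → V G) λ p →
      Injective _≡_ _≡_ p ×
      (∀ w → Star _~_ v w ⇔ (∃[ i ] p i ≡ w)) ×
      (∀ i j → (p i ~ p j) ⇔ Consecutive i j)

  LinearForest : Set
  LinearForest = ∀ v → ComponentIsPath v

------------------------------------------------------------------------
-- Vertex explosion

module _ (G : Graph) where
  open Graph G using (_~_; ~-sym; ~-irrefl)

  -- The proofs stored in these records are irrelevant, so there is exactly
  -- one survivor for every w ≢ v and one pendant for every neighbor of v.
  record Survivor (v : V G) : Set where
    constructor survivor
    field
      vertex     : V G
      .different : vertex ≢ v

  record Pendant (v : V G) : Set where
    constructor pendant
    field
      support   : V G
      .neighbor : v ~ support

  open Survivor
  open Pendant

  module _ (v : V G) where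

    ExplodedAdj : Survivor v ⊎ Pendant v → Survivor v ⊎ Pendant v → Set
    ExplodedAdj (inj₁ x) (inj₁ y) = vertex x ~ vertex y
    ExplodedAdj (inj₁ x) (inj₂ q) = vertex x ≡ support q
    ExplodedAdj (inj₂ q) (inj₁ x) = vertex x ≡ support q
    ExplodedAdj (inj₂ _) (inj₂ _) = ⊥

    private
      explodedSym : ∀ x y → ExplodedAdj x y → ExplodedAdj y x
      explodedSym (inj₁ _) (inj₁ _) e = ~-sym e
      explodedSym (inj₁ _) (inj₂ _) e = e
      explodedSym (inj₂ _) (inj₁ _) e = e

      explodedIrrefl : ∀ x → ¬ ExplodedAdj x x
      explodedIrrefl (inj₁ _) e = ~-irrefl e

    explode : Graph
    explode = record
      { V        = Survivor v ⊎ Pendant v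
      ; _~_      = ExplodedAdj
      ; ~-sym    = λ {x} {y} → explodedSym x y
      ; ~-irrefl = λ {x} → explodedIrrefl x
      }

explodeAll : ∀ n (G : Graph) (f : Fin n → V G) → Injective _≡_ _≡_ f → Graph
explodeAll zero    G f inj = G
explodeAll (suc n) G f inj = explodeAll n (explode G (f zero)) rest rest-injective
  where
  rest : Fin n → V (explode G (f zero))
  rest i = inj₁ (survivor (f (suc i)) λ eq → Fin.0≢1+n (sym (inj eq)))

  rest-injective : Injective _≡_ _≡_ rest
  rest-injective eq = Fin.suc-injective (inj (vertex-≡ eq))
    where
    vertex-≡ : ∀ {x y : Survivor G (f zero)} →
               _≡_ {A = Survivor G (f zero) ⊎ Pendant G (f zero)} (inj₁ x) (inj₁ y) →
               Survivor.vertex x ≡ Survivor.vertex y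
    vertex-≡ refl = refl

------------------------------------------------------------------------
-- Graphs on Fin n

-- A set of two-element subsets of Fin n.
record EdgeSet (n : ℕ) : Set where
  field
    has        : Fin n → Fin n → Bool
    has-sym    : ∀ u v → has u v ≡ has v u
    has-irrefl : ∀ v → has v v ≡ false

open EdgeSet public using (has)

module _ {n : ℕ} where

  _⊆ₑ_ : EdgeSet n → EdgeSet n → Set
  S ⊆ₑ E = ∀ u v → T (has S u v) → T (has E u v)

  edgeList : EdgeSet n → List (Fin n × Fin n)
  edgeList S = filterᵇ (λ (u , v) → does (u Fin.<? v) ∧ has S u v)
                       (cartesianProduct (allFin n) (allFin n))

  ∣_∣ₑ : EdgeSet n → ℕ
  ∣ S ∣ₑ = length (edgeList S)

  _∖_ : EdgeSet n → EdgeSet n → EdgeSet n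
  E ∖ S = record
    { has        = λ u v → has E u v ∧ not (has S u v)
    ; has-sym    = λ u v → cong₂ (λ x y → x ∧ not y) (EdgeSet.has-sym E u v)
                                                      (EdgeSet.has-sym S u v)
    ; has-irrefl = λ v → cong (_∧ not (has S v v)) (EdgeSet.has-irrefl E v)
    }

  graph : EdgeSet n → Graph
  graph E = record
    { V        = Fin n
    ; _~_      = λ u v → T (has E u v)
    ; ~-sym    = λ {u} {v} → subst T (EdgeSet.has-sym E u v)
    ; ~-irrefl = λ {v} → subst T (EdgeSet.has-irrefl E v)
    }

record FiniteGraph : Set where
  field
    order : ℕ
    edges : EdgeSet order

------------------------------------------------------------------------
-- Bipartite graphs with sides T = Fin t and B = Fin b

lookup-injective : ∀ {A : Set} {xs : List A} → Unique xs →
                   ∀ i j → List.lookup xs i ≡ List.lookup xs j → i ≡ j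
lookup-injective (_ ∷ _)   zero    zero    _  = refl
lookup-injective (x∉ ∷ _)  zero    (suc j) eq = contradiction eq (All.lookup x∉ (∈-lookup j))
lookup-injective (x∉ ∷ _)  (suc i) zero    eq = contradiction (sym eq) (All.lookup x∉ (∈-lookup i))
lookup-injective (_ ∷ xs!) (suc i) (suc j) eq = cong suc (lookup-injective xs! i j eq)

record BipartiteGraph : Set where
  field
    t b : ℕ
    adj : Fin t → Fin b → Bool

module _ (G : BipartiteGraph) where
  open BipartiteGraph G

  BipartiteAdj : Fin t ⊎ Fin b → Fin t ⊎ Fin b → Set
  BipartiteAdj (inj₁ x) (inj₁ _) = ⊥
  BipartiteAdj (inj₁ x) (inj₂ y) = T (adj x y)
  BipartiteAdj (inj₂ y) (inj₁ x) = T (adj x y)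
  BipartiteAdj (inj₂ y) (inj₂ _) = ⊥

  private
    bipartiteSym : ∀ x y → BipartiteAdj x y → BipartiteAdj y x
    bipartiteSym (inj₁ _) (inj₂ _) e = e
    bipartiteSym (inj₂ _) (inj₁ _) e = e

    bipartiteIrrefl : ∀ x → ¬ BipartiteAdj x x
    bipartiteIrrefl (inj₁ _) ()
    bipartiteIrrefl (inj₂ _) ()

  bipartite : Graph
  bipartite = record
    { V        = Fin t ⊎ Fin b
    ; _~_      = BipartiteAdj
    ; ~-sym    = λ {x} {y} → bipartiteSym x y
    ; ~-irrefl = λ {x} → bipartiteIrrefl x
    }

  elements : Subset b → List (Fin b)
  elements S = filter (_∈? S) (allFin b)

  elements-unique : ∀ S → Unique (elements S)
  elements-unique S = Unique.filter⁺ (_∈? S) (Unique.allFin⁺ b)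

  -- The vertices of S are exploded in increasing order.
  explodeSet : Subset b → Graph
  explodeSet S =
    explodeAll (length (elements S)) bipartite (inj₂ ∘ List.lookup (elements S))
      (λ eq → lookup-injective (elements-unique S) _ _ (inj₂-injective eq))

------------------------------------------------------------------------
-- Polynomial-time computation

-- Structured programs over r registers, each holding a word over Bool that
-- is used as a stack.  Every step acts on the top of at most one stack, so a
-- multitape Turing machine simulates it in constantly many steps by keeping
-- each stack on a tape of its own; conversely two stacks hold the two halves
-- of a tape, and further registers hold the machine state.  Hence polynomial
-- time here is polynomial time on multitape Turing machines.
data Program (r : ℕ) : Set where
  skip  : Program r
  push  : Fin r → Bool → Program r
  pop   : Fin r → Program r
  _⨾_   : Program r → Program r → Program r
  case  : Fin r → (empty top-false top-true : Program r) → Program r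
  while : Fin r → Program r → Program r

infixr 5 _⨾_

Store : ℕ → Set
Store r = Vec (List Bool) r

branch : ∀ {A : Set} → List Bool → A → A → A → A
branch []          x y z = x
branch (false ∷ _) x y z = y
branch (true  ∷ _) x y z = z

-- Runs c σ τ n: started in σ, the program c halts in τ after n steps.
-- The loop while i c repeats c as long as register i is nonempty.
data Runs {r} : Program r → Store r → Store r → ℕ → Set where
  skip : ∀ {σ} → Runs skip σ σ 1
  push : ∀ {σ i a} → Runs (push i a) σ (updateAt σ i (a ∷_)) 1
  pop  : ∀ {σ i} → Runs (pop i) σ (updateAt σ i (drop 1)) 1
  _⨾_  : ∀ {c d σ τ υ m n} → Runs c σ τ m → Runs d τ υ n → Runs (c ⨾ d) σ υ (m + n)
  case : ∀ {i c₀ c₁ c₂ σ τ n} →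
         Runs (branch (lookup σ i) c₀ c₁ c₂) σ τ n → Runs (case i c₀ c₁ c₂) σ τ (suc n)
  stop : ∀ {i c σ} → lookup σ i ≡ [] → Runs (while i c) σ σ 1
  loop : ∀ {i c σ τ υ m n} → lookup σ i ≢ [] →
         Runs c σ τ m → Runs (while i c) τ υ n → Runs (while i c) σ υ (suc (m + n))

-- Input and output are held in register 0; all other registers are
-- initially empty.
initial : ∀ {r} → List Bool → Store (suc r)
initial x = x Vec.∷ Vec.replicate _ []

record PolynomialTime {A B : Set} (codeA : A → List Bool) (codeB : B → List Bool)
                      (f : A → B) : Set where
  field
    r       : ℕ
    program : Program (suc r)
    c d     : ℕ
    correct : ∀ x → ∃[ τ ] ∃[ n ]
      ( Runs program (initial (codeA x)) τ n
      × Vec.head τ ≡ codeB (f x)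
      × n ≤ c * suc (length (codeA x)) ^ d )

------------------------------------------------------------------------
-- Parameterized problems and reductions

-- Bijective base 2, least significant digit first.
binary : ℕ → List Bool
binary = digits ∘ fromℕ
  where
  digits : ℕᵇ → List Bool
  digits zero     = []
  digits 2[1+ x ] = true  ∷ digits x
  digits 1+[2 x ] = false ∷ digits x

record ParameterizedProblem : Set₁ where
  field
    Input : Set
    code  : Input → List Bool
    Yes   : Input → ℕ → Set

  Instance : Set
  Instance = Input × ℕ

  -- All codes of inputs below are self-delimiting.
  codeInstance : Instance → List Bool
  codeInstance (I , k) = code I ++ binary k

record ParameterPreservingReduction (P Q : ParameterizedProblem) : Set where
  private
    module P = ParameterizedProblem P
    module Q = ParameterizedProblem Q
  field
    reduce         : P.Instance → Q.Instance
    polynomialTime : PolynomialTime P.codeInstance Q.codeInstance reduce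
    parameter      : ∀ I k → proj₂ (reduce (I , k)) ≤ k
    correct        : ∀ I k → P.Yes I k ⇔ (let (I′ , k′) = reduce (I , k) in Q.Yes I′ k′)

------------------------------------------------------------------------
-- Encodings: orders in unary, adjacency as a matrix listed row by row

unary : ℕ → List Bool
unary n = replicate n true ++ false ∷ []

matrix : ∀ {m n} → (Fin m → Fin n → Bool) → List Bool
matrix {m} {n} M = concatMap (λ i → List.map (M i) (allFin n)) (allFin m)

codeGraph : FiniteGraph → List Bool
codeGraph G = unary order ++ matrix (has edges)
  where open FiniteGraph G

codeBipartite : BipartiteGraph → List Bool
codeBipartite G = unary t ++ unary b ++ matrix adj
  where open BipartiteGraph G

------------------------------------------------------------------------
-- The four problems

BOVE : ParameterizedProblem
BOVE = record
  { Input = BipartiteGraph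
  ; code  = codeBipartite
  ; Yes   = λ G k → Σ (Subset (BipartiteGraph.b G)) λ S →
              ∣ S ∣ ≤ k × PathwidthAtMost (explodeSet G S) (+ 1)
  }

RestrictedBOVE : ParameterizedProblem
RestrictedBOVE = record
  { Input = Σ BipartiteGraph λ G → Subset (BipartiteGraph.b G)
  ; code  = λ (G , X) → codeBipartite G ++ Vec.toList X
  ; Yes   = λ (G , X) k → Σ (Subset (BipartiteGraph.b G)) λ S →
              S ⊆ X × ∣ S ∣ ≤ k × PathwidthAtMost (explodeSet G S) (+ 1)
  }

CPS : ParameterizedProblem
CPS = record
  { Input = FiniteGraph
  ; code  = codeGraph
  ; Yes   = λ G k → let open FiniteGraph G in
              Σ (EdgeSet order) λ S →
              S ⊆ₑ edges × ∣ S ∣ₑ ≤ k × LinearForest (graph (edges ∖ S))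
  }

RestrictedCPS : ParameterizedProblem
RestrictedCPS = record
  { Input = Σ FiniteGraph λ G → let open FiniteGraph G in
              Σ (EdgeSet order) λ X → X ⊆ₑ edges
  ; code  = λ (G , X , _) → codeGraph G ++ matrix (has X)
  ; Yes   = λ (G , X , _) k → let open FiniteGraph G in
              Σ (EdgeSet order) λ S →
              S ⊆ₑ X × ∣ S ∣ₑ ≤ k × LinearForest (graph (edges ∖ S))
  }

-- Subdivide every edge of G and let B be the set of subdivision vertices.  Exploding the subdivision
-- vertices of S leaves the subdivision of G - S with some pendant vertices attached to original vertices.
-- If G - S is a linear forest, this is a disjoint union of caterpillars, which has pathwidth at most one.
-- Conversely, in a path decomposition of width one the bags of adjacent original vertices u and v are
-- disjoint, and u has at most one neighbor on either side: two of them would put both subdivision vertices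
-- together with u into one bag.  Ordering the vertices by their bags then exhibits G - S as a linear forest.
--
-- To keep the program short, B has a vertex for every ordered pair (u , v), so that a set of edges is encoded
-- by its adjacency matrix and the part of the input after the matrix of G is output unchanged.  The row
-- of x in the output is the matrix of G masked by two words, which grow by prefixes as x increases.
module Submission where

open import Defs
open import Data.Bool.Base using (Bool; true; false; T; not; _∧_; _∨_)
open import Data.Bool.Properties using (T?; T-∧; T-∨; T-≡; ∨-comm; ∧-zeroʳ)
open import Data.Empty using (⊥; ⊥-elim-irr)
open import Data.Fin.Base using (Fin; zero; suc; toℕ; combine; remQuot; fromℕ<; inject≤; _↑ˡ_; _↑ʳ_)
import Data.Fin.Base as Fin
open import Data.Fin.Patterns
import Data.Fin.Properties as Fin
open import Data.Fin.Subset using (Subset; ∣_∣)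
import Data.Fin.Subset as Subset
open import Data.Fin.Subset.Properties using (_∈?_; drop-there)
open import Data.Integer.Base as ℤ using (_⊖_)
open import Data.List.Base as List
  using (List; []; _∷_; _++_; _ʳ++_; length; replicate; take; drop; concat; concatMap; map; tabulate;
         allFin; filter; deduplicate)
open import Data.List.Extrema.Nat using (xs≤max; max≤v⁺)
open import Data.List.Membership.Propositional using (_∈_; lose)
open import Data.List.Membership.Propositional.Properties
  using (∈-lookup; ∈-tabulate⁺; ∈-filter⁺; ∈-filter⁻; ∈-allFin; ∈-deduplicate⁺; ∈-concatMap⁺; ∈-map⁺;
         ∈-++⁺ˡ; ∈-++⁺ʳ; ∈-cartesianProduct⁺)
open import Data.List.Properties
  using (++-assoc; ++-identityʳ; ++-ʳ++; ʳ++-ʳ++; ʳ++-defn; reverse-involutive; length-reverse;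
         length-ʳ++; length-++; length-replicate; length-take; length-map; length-tabulate;
         take++drop≡id; map-tabulate; tabulate-cong; filter-≐)
open import Data.List.Relation.Unary.All as All using (All; []; _∷_)
import Data.List.Relation.Unary.All.Properties as All
open import Data.List.Relation.Unary.AllPairs using ([]; _∷_)
open import Data.List.Relation.Unary.Any as Any using (here; there)
open import Data.List.Relation.Unary.Any.Properties using (lookup-index)
import Data.List.Relation.Unary.Unique.DecPropositional.Properties as DecUnique
open import Data.List.Relation.Unary.Unique.Propositional using (Unique)
import Data.List.Relation.Unary.Unique.Propositional.Properties as Unique
open import Data.Nat.Base
open import Data.Nat.Divisibility using (divides)
open import Data.Nat.DivMod
  using (+-distrib-/-∣ʳ; m*n/n≡m; m<n⇒m/n≡0; [m+kn]%n≡m%n; m<n⇒m%n≡m; /-monoˡ-≤)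
open import Data.Nat.Properties hiding (_≟_)
import Data.Nat.Properties as ℕ
open import Data.Nat.Tactic.RingSolver using (solve-∀)
open import Data.Product.Base using (_×_; _,_; proj₁; proj₂; ∃-syntax; uncurry)
open import Data.Sum.Base as Sum using (_⊎_; inj₁; inj₂; [_,_]′)
import Data.Sum.Properties as Sum
open import Data.Vec.Base as Vec using ([]; _∷_; here; there; lookup; updateAt)
open import Data.Vec.Properties using (lookup∘tabulate; lookup⇒[]=; []=⇒lookup)
open import Function.Base using (_∘_; id)
open import Function.Bundles using (mk⇔; module Equivalence)
open import Function.Definitions using (Injective)
open import Relation.Binary.Construct.Closure.ReflexiveTransitive using (Star; ε; _◅_; _◅◅_; reverse)
open import Relation.Binary.Definitions using (DecidableEquality; tri<; tri≈; tri>)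
open import Relation.Binary.PropositionalEquality
open import Relation.Nullary
  using (¬_; Dec; does; yes; no; contradiction; recompute; map′; _×-dec_; _⊎-dec_)

-- Running times of programs

-- A program sees only the tops of its stacks, so it cannot compare or multiply indices; which bits
-- belong to a row must lie ready on a stack, as a mask. From row `x` to row `suc x` the mask of
-- `x = u` moves down one matrix row, by `n` bits, and the mask of `x = v < u` moves diagonally, by
-- `n + 1` bits.
--
-- Adjacent `u` and `v` have disjoint bags by the Helly property: each shares a bag with their
-- subdivision vertex, so a common bag of `u` and `v` would give a bag with all three.
--
-- A pair `(u , v)` that subdivides no edge is isolated or pendant at `u`: it adds at most a leaf to
-- a caterpillar, and it is dropped when a solution is translated back.
--
-- Each explosion changes the vertex type, so the final graph is a nested sum. In one direction a
-- `Layout` is carried through every explosion and becomes a decomposition only at the end; in the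
-- other, only the vertices outside the exploded set are followed.
--
-- A `LinearForest` gives each vertex a path of its own, with no agreement on directions. An
-- injective numbering in which neighbors are consecutive replaces these paths.

Runs≤ : ∀ {r} → Program r → Store r → Store r → ℕ → Set
Runs≤ c σ τ t = ∃[ n ] (Runs c σ τ n × n ≤ t)

loopTime : ℕ → ℕ → ℕ
loopTime zero    t = 1
loopTime (suc k) t = suc (t + loopTime k t)

module _ {r : ℕ} where

  exactly : ∀ {c : Program r} {σ τ n} → Runs c σ τ n → Runs≤ c σ τ n
  exactly p = _ , p , ≤-refl

  relax : ∀ {c : Program r} {σ τ s t} → s ≤ t → Runs≤ c σ τ s → Runs≤ c σ τ t
  relax s≤t (n , p , n≤s) = n , p , ≤-trans n≤s s≤t

  infixr 5 _⨾≤_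
  _⨾≤_ : ∀ {c d : Program r} {σ τ υ s t} →
         Runs≤ c σ τ s → Runs≤ d τ υ t → Runs≤ (c ⨾ d) σ υ (s + t)
  (_ , p , p≤) ⨾≤ (_ , q , q≤) = _ , p ⨾ q , +-mono-≤ p≤ q≤

  push≤ : ∀ {i a} {σ : Store r} → Runs≤ (push i a) σ (updateAt σ i (a ∷_)) 1
  push≤ = exactly push

  pop≤ : ∀ {i} {σ : Store r} → Runs≤ (pop i) σ (updateAt σ i (drop 1)) 1
  pop≤ = exactly pop

  case≤ : ∀ {i c₀ c₁ c₂} {σ τ : Store r} {t} →
          Runs≤ (branch (lookup σ i) c₀ c₁ c₂) σ τ t → Runs≤ (case i c₀ c₁ c₂) σ τ (suc t)
  case≤ (_ , p , p≤) = _ , case p , s≤s p≤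

  stop≤ : ∀ {i} {c : Program r} {σ} → lookup σ i ≡ [] → Runs≤ (while i c) σ σ 1
  stop≤ eq = exactly (stop eq)

  loop≤ : ∀ {i} {c : Program r} {σ τ υ t} k → lookup σ i ≢ [] →
          Runs≤ c σ τ t → Runs≤ (while i c) τ υ (loopTime k t) →
          Runs≤ (while i c) σ υ (loopTime (suc k) t)
  loop≤ k ne (_ , p , p≤) (_ , q , q≤) = _ , loop ne p q , s≤s (+-mono-≤ p≤ q≤)

  shift : Fin r → Fin r → Program r
  shift i j = case i skip (pop i ⨾ push j false) (pop i ⨾ push j true)

  shift≤ : ∀ {i j x xs} {σ : Store r} → lookup σ i ≡ x ∷ xs →
           Runs≤ (shift i j) σ (updateAt (updateAt σ i (drop 1)) j (x ∷_)) 3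
  shift≤ {x = x} eq = case≤ (lemma x eq)
    where
    lemma : ∀ {i j xs} {σ : Store r} x → lookup σ i ≡ x ∷ xs →
            Runs≤ (branch (lookup σ i) skip (pop i ⨾ push j false) (pop i ⨾ push j true))
                  σ (updateAt (updateAt σ i (drop 1)) j (x ∷_)) 2
    lemma false eq rewrite eq = pop≤ ⨾≤ push≤
    lemma true  eq rewrite eq = pop≤ ⨾≤ push≤

  move : Fin r → Fin r → Program r
  move i j = while i (shift i j)

-- The program that writes the incidence matrix

-- N holds the order n, A and B count the rows still to be read and written, M is the matrix, R and C are
-- the masks of the current row, and Q is the output in reverse.  A prime marks the register into which a
-- word is moved while it is traversed.
pattern rIO = 0F
pattern rN  = 1F
pattern rN′ = 2F
pattern rA  = 3F
pattern rB  = 4F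
pattern rM  = 5F
pattern rM′ = 6F
pattern rR  = 7F
pattern rR′ = 8F
pattern rC  = 9F
pattern rC′ = suc 9F
pattern rQ  = suc (suc 9F)

variable
  io N N′ A B M M′ R R′ C C′ Q : List Bool

store : (io N N′ A B M M′ R R′ C C′ Q : List Bool) → Store 12
store io N N′ A B M M′ R R′ C C′ Q =
  io ∷ N ∷ N′ ∷ A ∷ B ∷ M ∷ M′ ∷ R ∷ R′ ∷ C ∷ C′ ∷ Q ∷ []

replicate-shift : ∀ k (x : Bool) xs → replicate k x ++ x ∷ xs ≡ x ∷ replicate k x ++ xs
replicate-shift zero    x xs = refl
replicate-shift (suc k) x xs = cong (x ∷_) (replicate-shift k x xs)

trues falses : ℕ → List Bool
trues k = replicate k true
falses k = replicate k false

-- `while` tests only for emptiness, so a single bit on `rN′` acts as the loop flag, which the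
-- `false` ending the unary number removes. The order is stored three times because the loops over
-- the rows read and written use up `rA` and `rB`.
parseBit : Program 12
parseBit = case rIO skip
  (pop rN′ ⨾ pop rIO ⨾ push rQ false)
  (pop rIO ⨾ push rN true ⨾ push rA true ⨾ push rB true ⨾ push rQ true)

parseOrder : Program 12
parseOrder = push rN′ true ⨾ while rN′ parseBit

parseOrder≤ : ∀ n → Runs≤ parseOrder
  (store (unary n ++ io) N [] A B M M′ R R′ C C′ Q)
  (store io (trues n ++ N) [] (trues n ++ A) (trues n ++ B) M M′ R R′ C C′
         (false ∷ trues n ++ Q))
  (1 + loopTime (suc n) 6)
parseOrder≤ n = push≤ ⨾≤ go n
  where
  go : ∀ n → Runs≤ (while rN′ parseBit)
    (store (unary n ++ io) N (true ∷ []) A B M M′ R R′ C C′ Q)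
    (store io (trues n ++ N) [] (trues n ++ A) (trues n ++ B) M M′ R R′ C C′
           (false ∷ trues n ++ Q))
    (loopTime (suc n) 6)
  go zero = loop≤ 0 (λ ()) (relax (m≤m+n 4 2) (case≤ (pop≤ ⨾≤ pop≤ ⨾≤ push≤))) (stop≤ refl)
  go {N = N} {A} {B} {Q = Q} (suc n)
    rewrite sym (replicate-shift n true N) | sym (replicate-shift n true A)
          | sym (replicate-shift n true B) | sym (replicate-shift n true Q) =
    loop≤ (suc n) (λ ()) (case≤ (pop≤ ⨾≤ push≤ ⨾≤ push≤ ⨾≤ push≤ ⨾≤ push≤)) (go n)

forN : Program 12 → Program 12
forN body = while rN (shift rN rN′ ⨾ body)

restoreN : Program 12
restoreN = move rN′ rN

restoreN≤ : ∀ k → Runs≤ restoreN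
  (store io [] (trues k ++ []) A B M M′ R R′ C C′ Q)
  (store io (trues k) [] A B M M′ R R′ C C′ Q)
  (loopTime k 3)
restoreN≤ k rewrite sym (++-identityʳ (trues k)) | ++-identityʳ (trues k ++ []) = go k
  where
  go : ∀ k → Runs≤ restoreN
    (store io N (trues k ++ []) A B M M′ R R′ C C′ Q)
    (store io (trues k ++ N) [] A B M M′ R R′ C C′ Q)
    (loopTime k 3)
  go zero = stop≤ refl
  go {N = N} (suc k) rewrite sym (replicate-shift k true N) =
    loop≤ k (λ ()) (shift≤ refl) (go k)

-- Every matrix entry also puts a `true` on `rQ`, so that reading all rows writes `n * n` in unary
-- without a multiplication, and a `false` on each mask, so that the masks become long enough to
-- cover the matrix.
readBit : Program 12
readBit = shift rIO rM′ ⨾ push rQ true ⨾ push rR false ⨾ push rC false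

readRow : Program 12
readRow = forN readBit ⨾ restoreN

readRow≤ : ∀ ms {n} → length ms ≡ n → Runs≤ readRow
  (store (ms ++ io) (trues n) [] A B M M′ R R′ C C′ Q)
  (store io (trues n) [] A B M (ms ʳ++ M′) (falses n ++ R) R′ (falses n ++ C) C′
         (trues n ++ Q))
  (loopTime n 9 + loopTime n 3)
readRow≤ ms refl = go ms ⨾≤ restoreN≤ (length ms)
  where
  go : ∀ ms → let n = length ms in Runs≤ (forN readBit)
    (store (ms ++ io) (trues n) N′ A B M M′ R R′ C C′ Q)
    (store io [] (trues n ++ N′) A B M (ms ʳ++ M′) (falses n ++ R) R′ (falses n ++ C) C′
           (trues n ++ Q))
    (loopTime n 9)
  go [] = stop≤ refl
  go {N′ = N′} {R = R} {C = C} {Q = Q} (m ∷ ms)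
    rewrite sym (replicate-shift (length ms) true N′) | sym (replicate-shift (length ms) true Q)
          | sym (replicate-shift (length ms) false R) | sym (replicate-shift (length ms) false C) =
    loop≤ (length ms) (λ ()) (shift≤ refl ⨾≤ shift≤ refl ⨾≤ push≤ ⨾≤ push≤ ⨾≤ push≤) (go ms)

-- readRow pushes n falses on C; replacing the topmost by true completes a period.
readMatrix : Program 12
readMatrix = while rA (pop rA ⨾ readRow ⨾ pop rC ⨾ push rC true)

period : ℕ → List Bool
period n = true ∷ falses (pred n)

replicate-+ : ∀ m n (x : Bool) xs → replicate n x ++ replicate m x ++ xs ≡ replicate (m + n) x ++ xs
replicate-+ zero    n x xs = refl
replicate-+ (suc m) n x xs = trans (replicate-shift n x _) (cong (x ∷_) (replicate-+ m n x xs))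

concat-replicate-shift : ∀ k (p xs : List Bool) →
  concat (replicate k p) ++ p ++ xs ≡ p ++ concat (replicate k p) ++ xs
concat-replicate-shift zero    p xs = refl
concat-replicate-shift (suc k) p xs = begin
  (p ++ concat (replicate k p)) ++ p ++ xs ≡⟨ ++-assoc p _ _ ⟩
  p ++ concat (replicate k p) ++ p ++ xs   ≡⟨ cong (p ++_) (concat-replicate-shift k p xs) ⟩
  p ++ p ++ concat (replicate k p) ++ xs   ≡⟨ cong (p ++_) (++-assoc p _ _) ⟨
  p ++ (p ++ concat (replicate k p)) ++ xs ∎
  where open ≡-Reasoning

readMatrix≤ : ∀ n rows → length rows ≤ n → All (λ r → length r ≡ n) rows → let k = length rows in
  Runs≤ readMatrix
  (store (concat rows ++ io) (trues n) [] (trues k) B M M′ R R′ C C′ Q)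
  (store io (trues n) [] [] B M (concat rows ʳ++ M′) (falses (k * n) ++ R) R′
         (concat (replicate k (period n)) ++ C) C′ (trues (k * n) ++ Q))
  (loopTime k (1 + (loopTime n 9 + loopTime n 3 + 2)))
readMatrix≤ n [] _ [] = stop≤ refl
-- A nonempty list of at most `n` rows forces `n` to be positive, so the row just read has left a
-- `false` on `rC` that can be replaced.
readMatrix≤ {io} {M′ = M′} {R = R} {C = C} {Q = Q} n@(suc n-1) (row ∷ rows) (s≤s k≤) (eq ∷ eqs)
  rewrite ++-assoc row (concat rows) io
        | ++-ʳ++ row {concat rows} {M′}
        | sym (replicate-+ n (length rows * n) false R)
        | sym (replicate-+ n (length rows * n) true Q)
        | ++-assoc (period n) (concat (replicate (length rows) (period n))) C
        | sym (concat-replicate-shift (length rows) (period n) C) =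
  loop≤ (length rows) (λ ()) (pop≤ ⨾≤ readRow≤ row eq ⨾≤ pop≤ ⨾≤ push≤)
    (readMatrix≤ n rows (m≤n⇒m≤1+n k≤) eqs)

initialBit : Program 12
initialBit = push rR true ⨾ push rC false

-- These are the masks for `x = 0`. The block `u = 0` is all `true` in the row mask and all `false`
-- in the column mask, since `v < u` fails there; every later block of the column mask is a period,
-- with its only `true` at `v = 0`. The final `move` undoes the reversal caused by reading.
initialMasks : Program 12
initialMasks = forN initialBit ⨾ restoreN ⨾ push rQ false ⨾ move rM′ rM

move≤ : ∀ ms → Runs≤ (move rM′ rM)
  (store io N N′ A B M ms R R′ C C′ Q) (store io N N′ A B (ms ʳ++ M) [] R R′ C C′ Q)
  (loopTime (length ms) 3)
move≤ []       = stop≤ refl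
move≤ (m ∷ ms) = loop≤ (length ms) (λ ()) (shift≤ refl) (move≤ ms)

initialMasks≤ : ∀ n ms {l} → length ms ≡ l → Runs≤ initialMasks
  (store io (trues n) [] A B [] (ms ʳ++ []) R R′ C C′ Q)
  (store io (trues n) [] A B ms [] (trues n ++ R) R′ (falses n ++ C) C′ (false ∷ Q))
  (loopTime n 5 + (loopTime n 3 + (1 + loopTime l 3)))
initialMasks≤ {io} {A} {B} {R} {R′} {C} {C′} {Q} n ms refl =
  go n ⨾≤ restoreN≤ n ⨾≤ push≤ ⨾≤
  subst₂ (λ xs t → Runs≤ (move rM′ rM)
           (store io (trues n) [] A B [] (ms ʳ++ []) (trues n ++ R) R′ (falses n ++ C) C′ (false ∷ Q))
           (store io (trues n) [] A B xs [] (trues n ++ R) R′ (falses n ++ C) C′ (false ∷ Q))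
           (loopTime t 3))
         (reverse-involutive ms) (length-reverse ms) (move≤ (ms ʳ++ []))
  where
  go : ∀ {N′ R C} n → Runs≤ (forN initialBit)
    (store io (trues n) N′ A B M M′ R R′ C C′ Q)
    (store io [] (trues n ++ N′) A B M M′ (trues n ++ R) R′ (falses n ++ C) C′ Q)
    (loopTime n 5)
  go zero = stop≤ refl
  go {N′ = N′} {R = R} {C = C} (suc n)
    rewrite sym (replicate-shift n true N′) | sym (replicate-shift n true R)
          | sym (replicate-shift n false C) =
    loop≤ n (λ ()) (shift≤ refl ⨾≤ push≤ ⨾≤ push≤) (go n)

maskBit : Program 12
maskBit = case rM skip
  (push rQ false)
  (case rR skip
    (case rC skip (push rQ false) (push rQ true))
    (push rQ true))

writeBit : Program 12
writeBit = maskBit ⨾ shift rM rM′ ⨾ shift rR rR′ ⨾ shift rC rC′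

restoreBit : Program 12
restoreBit = shift rM′ rM ⨾ shift rR′ rR ⨾ shift rC′ rC

-- The loops are controlled by the matrix alone. The masks may therefore be longer, as they become
-- after each row, and their excess stays in place below.
writeRow : Program 12
writeRow = while rM writeBit ⨾ while rM′ restoreBit

masked : (ms rs cs : List Bool) → List Bool
masked (m ∷ ms) (r ∷ rs) (c ∷ cs) = (m ∧ (r ∨ c)) ∷ masked ms rs cs
masked _        _        _        = []

maskBit≤ : ∀ m r c → Runs≤ maskBit
  (store io N N′ A B (m ∷ M) M′ (r ∷ R) R′ (c ∷ C) C′ Q)
  (store io N N′ A B (m ∷ M) M′ (r ∷ R) R′ (c ∷ C) C′ ((m ∧ (r ∨ c)) ∷ Q)) 4
maskBit≤ false r     c     = relax (m≤m+n 2 2) (case≤ push≤)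
maskBit≤ true  true  c     = relax (m≤m+n 3 1) (case≤ (case≤ push≤))
maskBit≤ true  false true  = case≤ (case≤ (case≤ push≤))
maskBit≤ true  false false = case≤ (case≤ (case≤ push≤))

writeRow≤ : ∀ ms rs cs → length rs ≡ length ms → length cs ≡ length ms → Runs≤ writeRow
  (store io N N′ A B ms [] (rs ++ R) [] (cs ++ C) [] Q)
  (store io N N′ A B ms [] (rs ++ R) [] (cs ++ C) [] (masked ms rs cs ʳ++ Q))
  (loopTime (length ms) 13 + loopTime (length ms) 9)
writeRow≤ {R = R} {C} ms rs cs lr lc = write ms rs cs lr lc ⨾≤ restore′
  where
  write : ∀ ms rs cs → length rs ≡ length ms → length cs ≡ length ms → Runs≤ (while rM writeBit)
    (store io N N′ A B ms M′ (rs ++ R) R′ (cs ++ C) C′ Q)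
    (store io N N′ A B [] (ms ʳ++ M′) R (rs ʳ++ R′) C (cs ʳ++ C′) (masked ms rs cs ʳ++ Q))
    (loopTime (length ms) 13)
  write []       []       []       _  _  = stop≤ refl
  write (m ∷ ms) (r ∷ rs) (c ∷ cs) lr lc =
    loop≤ (length ms) (λ ()) (maskBit≤ m r c ⨾≤ shift≤ refl ⨾≤ shift≤ refl ⨾≤ shift≤ refl)
          (write ms rs cs (suc-injective lr) (suc-injective lc))
  restore : ∀ {R C} ms rs cs → length rs ≡ length ms → length cs ≡ length ms → Runs≤ (while rM′ restoreBit)
    (store io N N′ A B M ms R rs C cs Q)
    (store io N N′ A B (ms ʳ++ M) [] (rs ʳ++ R) [] (cs ʳ++ C) [] Q)
    (loopTime (length ms) 9)
  restore []       []       []       _  _  = stop≤ refl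
  restore (m ∷ ms) (r ∷ rs) (c ∷ cs) lr lc =
    loop≤ (length ms) (λ ()) (shift≤ refl ⨾≤ shift≤ refl ⨾≤ shift≤ refl)
          (restore ms rs cs (suc-injective lr) (suc-injective lc))
  reverse-reverse : ∀ (xs ys : List Bool) → (xs ʳ++ []) ʳ++ ys ≡ xs ++ ys
  reverse-reverse xs ys = begin
    (xs ʳ++ []) ʳ++ ys             ≡⟨ ʳ++-defn (xs ʳ++ []) ⟩
    ((xs ʳ++ []) ʳ++ []) ++ ys     ≡⟨ cong (_++ ys) (reverse-involutive xs) ⟩
    xs ++ ys                       ∎
    where open ≡-Reasoning
  restore′ : Runs≤ (while rM′ restoreBit)
    (store io N N′ A B [] (ms ʳ++ []) R (rs ʳ++ []) C (cs ʳ++ []) Q)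
    (store io N N′ A B ms [] (rs ++ R) [] (cs ++ C) [] Q)
    (loopTime (length ms) 9)
  restore′ {io} {N} {N′} {A} {B} {Q} rewrite sym (reverse-reverse rs R) | sym (reverse-reverse cs C) =
    subst₂ (λ xs t → Runs≤ (while rM′ restoreBit)
             (store io N N′ A B [] (ms ʳ++ []) R (rs ʳ++ []) C (cs ʳ++ []) Q)
             (store io N N′ A B xs [] ((rs ʳ++ []) ʳ++ R) [] ((cs ʳ++ []) ʳ++ C) [] Q) (loopTime t 9))
      (reverse-involutive ms) (length-reverse ms)
      (restore (ms ʳ++ []) (rs ʳ++ []) (cs ʳ++ [])
        (trans (length-reverse rs) (trans lr (sym (length-reverse ms))))
        (trans (length-reverse cs) (trans lc (sym (length-reverse ms)))))

moveMasksBit : Program 12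
moveMasksBit = push rR false ⨾ push rC false

moveMasks : Program 12
moveMasks = forN moveMasksBit ⨾ restoreN ⨾ push rC false

moveMasks≤ : ∀ n → Runs≤ moveMasks
  (store io (trues n) [] A B M M′ R R′ C C′ Q)
  (store io (trues n) [] A B M M′ (falses n ++ R) R′ (false ∷ falses n ++ C) C′ Q)
  (loopTime n 5 + (loopTime n 3 + 1))
moveMasks≤ n = go n ⨾≤ restoreN≤ n ⨾≤ push≤
  where
  go : ∀ n → Runs≤ (forN moveMasksBit)
    (store io (trues n) N′ A B M M′ R R′ C C′ Q)
    (store io [] (trues n ++ N′) A B M M′ (falses n ++ R) R′ (falses n ++ C) C′ Q)
    (loopTime n 5)
  go zero = stop≤ refl
  go {N′ = N′} {R = R} {C = C} (suc n)
    rewrite sym (replicate-shift n true N′) | sym (replicate-shift n false R)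
          | sym (replicate-shift n false C) =
    loop≤ n (λ ()) (shift≤ refl ⨾≤ push≤ ⨾≤ push≤) (go n)

rowsFrom : (n k : ℕ) (ms R C : List Bool) → List Bool
rowsFrom n zero    ms R C = []
rowsFrom n (suc k) ms R C =
  masked ms (take (length ms) R) (take (length ms) C) ++
  rowsFrom n k ms (falses n ++ R) (false ∷ falses n ++ C)

writeRows : Program 12
writeRows = while rB (pop rB ⨾ writeRow ⨾ moveMasks)

writeRows≤ : ∀ n k ms {l} → length ms ≡ l → length ms ≤ length R → length ms ≤ length C →
  ∃[ R″ ] ∃[ C″ ] Runs≤ writeRows
    (store io (trues n) [] A (trues k) ms [] R [] C [] Q)
    (store io (trues n) [] A [] ms [] R″ [] C″ [] (rowsFrom n k ms R C ʳ++ Q))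
    (loopTime k (1 + ((loopTime l 13 + loopTime l 9) +
                      (loopTime n 5 + (loopTime n 3 + 1)))))
writeRows≤ n zero ms _ lr lc = _ , _ , stop≤ refl
writeRows≤ {R = R} {C} {Q = Q} n (suc k) ms refl lr lc
  rewrite ++-ʳ++ (masked ms (take (length ms) R) (take (length ms) C))
            {rowsFrom n k ms (falses n ++ R) (false ∷ falses n ++ C)} {Q} =
  let _ , _ , rest = writeRows≤ n k ms refl
                       (≤-trans lr (length-≤-++ (falses n) R))
                       (≤-trans lc (m≤n⇒m≤1+n (length-≤-++ (falses n) C)))
  in _ , _ , loop≤ k (λ ()) (pop≤ ⨾≤ row ⨾≤ moveMasks≤ n) rest
  where
  length-≤-++ : ∀ (xs ys : List Bool) → length ys ≤ length (xs ++ ys)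
  length-≤-++ xs ys = ≤-trans (m≤n+m _ _) (≤-reflexive (sym (length-++ xs)))
  length-take-≤ : ∀ {xs : List Bool} → length ms ≤ length xs → length (take (length ms) xs) ≡ length ms
  length-take-≤ {xs} l≤ = trans (length-take (length ms) xs) (m≤n⇒m⊓n≡m l≤)
  row : ∀ {io N N′ A B Q} → Runs≤ writeRow
    (store io N N′ A B ms [] R [] C [] Q)
    (store io N N′ A B ms [] R [] C []
      (masked ms (take (length ms) R) (take (length ms) C) ʳ++ Q))
    (loopTime (length ms) 13 + loopTime (length ms) 9)
  row {io} {N} {N′} {A} {B} {Q} =
    subst₂ (λ R′ C′ → Runs≤ writeRow (store io N N′ A B ms [] R′ [] C′ [] Q)
                        (store io N N′ A B ms [] R′ [] C′ []
                          (masked ms (take (length ms) R) (take (length ms) C) ʳ++ Q))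
                        (loopTime (length ms) 13 + loopTime (length ms) 9))
      (take++drop≡id (length ms) R) (take++drop≡id (length ms) C)
      (writeRow≤ ms (take (length ms) R) (take (length ms) C) (length-take-≤ lr) (length-take-≤ lc))

output≤ : ∀ Q → Runs≤ (while rQ (shift rQ rIO))
  (store io N N′ A B M M′ R R′ C C′ Q) (store (Q ʳ++ io) N N′ A B M M′ R R′ C C′ [])
  (loopTime (length Q) 3)
output≤ []      = stop≤ refl
output≤ (q ∷ Q) = loop≤ (length Q) (λ ()) (shift≤ refl) (output≤ Q)

program : Program 12
program = parseOrder ⨾ readMatrix ⨾ initialMasks ⨾ writeRows ⨾ move rQ rIO

-- A polynomial bound on the running time

-- The coefficient and the degree are indices so that they are inferred from the shape of t.
record Bounded (L c d t : ℕ) : Set where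
  constructor bounded
  field bound : t ≤ c * L ^ d

module _ {L : ℕ} .{{_ : NonZero L}} where

  const : ∀ k → Bounded L k 0 k
  const k = bounded (≤-reflexive (sym (*-identityʳ k)))

  linear : ∀ {k} → k ≤ L → Bounded L 1 1 k
  linear k≤L = bounded (≤-trans k≤L (≤-reflexive (sym (trans (*-identityˡ _) (*-identityʳ L)))))

  infixl 6 _⊕_
  -- As `L` is at least 1, both powers are at most `L ^ (d + d′)`. The sum of the degrees is cruder
  -- than their maximum, but sums and products of bounds then treat degrees alike.
  _⊕_ : ∀ {s t c d c′ d′} → Bounded L c d s → Bounded L c′ d′ t → Bounded L (c + c′) (d + d′) (s + t)
  _⊕_ {s} {t} {c} {d} {c′} {d′} (bounded s≤) (bounded t≤) = bounded (begin
    s + t                                        ≤⟨ +-mono-≤ s≤ t≤ ⟩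
    c * L ^ d + c′ * L ^ d′                      ≤⟨ +-mono-≤ (*-monoʳ-≤ c (^-monoʳ-≤ L (m≤m+n d d′)))
                                                             (*-monoʳ-≤ c′ (^-monoʳ-≤ L (m≤n+m d′ d))) ⟩
    c * L ^ (d + d′) + c′ * L ^ (d + d′)         ≡⟨ *-distribʳ-+ (L ^ (d + d′)) c c′ ⟨
    (c + c′) * L ^ (d + d′)                      ∎)
    where open ≤-Reasoning

  infixl 7 _⊗_
  _⊗_ : ∀ {s t c d c′ d′} → Bounded L c d s → Bounded L c′ d′ t → Bounded L (c * c′) (d + d′) (s * t)
  _⊗_ {s} {t} {c} {d} {c′} {d′} (bounded s≤) (bounded t≤) = bounded (begin
    s * t                       ≤⟨ *-mono-≤ s≤ t≤ ⟩
    c * L ^ d * (c′ * L ^ d′)   ≡⟨ rearrange c (L ^ d) c′ (L ^ d′) ⟩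
    c * c′ * (L ^ d * L ^ d′)   ≡⟨ cong (c * c′ *_) (^-distribˡ-+-* L d d′) ⟨
    c * c′ * L ^ (d + d′)       ∎)
    where
    open ≤-Reasoning
    rearrange : ∀ a b c d → a * b * (c * d) ≡ a * c * (b * d)
    rearrange = solve-∀

  loops : ∀ {k t c d c′ d′} → Bounded L c d k → Bounded L c′ d′ t →
          Bounded L (1 + c * (1 + c′)) (d + d′) (loopTime k t)
  loops {k} {t} k≤ t≤ =
    subst (Bounded L _ _) (sym (closed k t)) (const 1 ⊕ k≤ ⊗ (const 1 ⊕ t≤))
    where
    closed : ∀ k t → loopTime k t ≡ 1 + k * (1 + t)
    closed zero    t = refl
    closed (suc k) t = cong suc (trans (cong (t +_) (closed k t)) (+-suc t _))

initialR initialC : ℕ → List Bool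
initialR n = trues n ++ falses (n * n) ++ []
initialC n = falses n ++ concat (replicate n (period n)) ++ []

expand : ℕ → List Bool → List Bool
expand n ms = unary n ++ unary (n * n) ++ rowsFrom n n ms (initialR n) (initialC n)

rowTime : ℕ → ℕ
rowTime n = 1 + ((loopTime (n * n) 13 + loopTime (n * n) 9) + (loopTime n 5 + (loopTime n 3 + 1)))

outputLength : ℕ → ℕ
outputLength n = n * (n * n) + (1 + (n * n + (1 + n)))

programTime : ℕ → ℕ
programTime n =
  (1 + loopTime (1 + n) 6) +
  (loopTime n (1 + (loopTime n 9 + loopTime n 3 + 2)) +
  ((loopTime n 5 + (loopTime n 3 + (1 + loopTime (n * n) 3))) +
  (loopTime n (rowTime n) + loopTime (outputLength n) 3)))

programTime-polynomial : ∀ {L n} .{{_ : NonZero L}} → n ≤ L → Bounded L _ _ (programTime n)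
programTime-polynomial {L} {n} n≤L =
  (k 1 ⊕ loops (k 1 ⊕ m) (k 6)) ⊕
  (loops m (k 1 ⊕ (loops m (k 9) ⊕ loops m (k 3) ⊕ k 2)) ⊕
  ((loops m (k 5) ⊕ (loops m (k 3) ⊕ (k 1 ⊕ loops (m ⊗ m) (k 3)))) ⊕
  (loops m (k 1 ⊕ ((loops (m ⊗ m) (k 13) ⊕ loops (m ⊗ m) (k 9)) ⊕
                   (loops m (k 5) ⊕ (loops m (k 3) ⊕ k 1)))) ⊕
   loops (m ⊗ (m ⊗ m) ⊕ (k 1 ⊕ (m ⊗ m ⊕ (k 1 ⊕ m)))) (k 3))))
  where
  m = linear n≤L
  k = const

-- Unfolding the power c * L ^ d, with d a numeral, is infeasible; hence abstract.
abstract
  programTime-bound : ∃[ c ] ∃[ d ] (∀ {n} l → n ≤ suc l → Bounded (suc l) c d (programTime n))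
  programTime-bound = _ , _ , λ l n≤ → programTime-polynomial n≤

length-concat : ∀ {n} rows → All (λ (r : List Bool) → length r ≡ n) rows → length (concat rows) ≡ length rows * n
length-concat []           []         = refl
length-concat (row ∷ rows) (eq ∷ eqs) =
  trans (length-++ row) (cong₂ _+_ eq (length-concat rows eqs))

length-rowsFrom : ∀ n k ms R C → length (rowsFrom n k ms R C) ≤ k * length ms
length-rowsFrom n zero    ms R C = z≤n
length-rowsFrom n (suc k) ms R C = ≤-trans (≤-reflexive (length-++ (masked ms _ _)))
  (+-mono-≤ (length-masked ms _ _) (length-rowsFrom n k ms _ _))
  where
  length-masked : ∀ ms rs cs → length (masked ms rs cs) ≤ length ms
  length-masked []       _        _        = z≤n
  length-masked (m ∷ ms) []       _        = z≤n
  length-masked (m ∷ ms) (r ∷ rs) []       = z≤n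
  length-masked (m ∷ ms) (r ∷ rs) (c ∷ cs) = s≤s (length-masked ms rs cs)

loopTime-mono : ∀ {k k′} t → k ≤ k′ → loopTime k t ≤ loopTime k′ t
loopTime-mono {k′ = zero}   t z≤n = ≤-refl
loopTime-mono {k′ = suc k′} t z≤n = s≤s z≤n
loopTime-mono t (s≤s k≤) = s≤s (+-monoʳ-≤ t (loopTime-mono t k≤))

replicate-ʳ++ : ∀ k (x : Bool) xs ys → (replicate k x ++ xs) ʳ++ ys ≡ xs ʳ++ (replicate k x ++ ys)
replicate-ʳ++ zero    x xs ys = refl
replicate-ʳ++ (suc k) x xs ys =
  trans (replicate-ʳ++ k x xs (x ∷ ys)) (cong (xs ʳ++_) (replicate-shift k x ys))

length-++-replicate : ∀ k (x : Bool) xs → length (replicate k x ++ xs) ≡ k + length xs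
length-++-replicate k x xs = trans (length-++ (replicate k x)) (cong (_+ length xs) (length-replicate k))

initialR-long : ∀ n → n * n ≤ length (initialR n)
initialR-long n = begin
  n * n                              ≤⟨ m≤m+n (n * n) 0 ⟩
  n * n + 0                          ≤⟨ m≤n+m (n * n + 0) n ⟩
  n + (n * n + 0)                    ≡⟨ cong (n +_) (length-++-replicate (n * n) false []) ⟨
  n + length (falses (n * n) ++ [])  ≡⟨ length-++-replicate n true _ ⟨
  length (initialR n)                ∎
  where open ≤-Reasoning

initialC-long : ∀ n → n * n ≤ length (initialC n)
initialC-long n = begin
  n * n                                ≤⟨ periods n n ⟩
  length (concat (replicate n (period n)))     ≡⟨ cong length (++-identityʳ (concat (replicate n (period n)))) ⟨
  length (concat (replicate n (period n)) ++ [])     ≤⟨ m≤n+m _ n ⟩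
  n + length (concat (replicate n (period n)) ++ [])  ≡⟨ length-++-replicate n false _ ⟨
  length (initialC n)                  ∎
  where
  open ≤-Reasoning
  suc-pred≥ : ∀ n → n ≤ suc (pred n)
  suc-pred≥ zero    = z≤n
  suc-pred≥ (suc n) = ≤-refl
  periods : ∀ k n → k * n ≤ length (concat (replicate k (period n)))
  periods zero    n = z≤n
  periods (suc k) n = begin
    n + k * n
      ≤⟨ +-mono-≤ (≤-trans (suc-pred≥ n) (≤-reflexive (sym (cong suc (length-replicate (pred n))))))
                  (periods k n) ⟩
    length (period n) + length (concat (replicate k (period n))) ≡⟨ length-++ (period n) ⟨
    length (period n ++ concat (replicate k (period n))) ∎

program-correct : ∀ n rows rest → length rows ≡ n → All (λ r → length r ≡ n) rows →
  ∃[ τ ] ∃[ t ] (Runs program (initial (unary n ++ concat rows ++ rest)) τ t ×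
                 Vec.head τ ≡ expand n (concat rows) ++ rest × t ≤ programTime n)
program-correct n rows rest refl eqs =
  let _ , _ , writes = writeRows≤ {R₀} {C₀} {rest} {[]} {Q₀} n n ms lms R-long C-long
      t , p , t≤ = start ⨾≤ readMatrix≤ {rest} n rows ≤-refl eqs ⨾≤ initialMasks≤ n ms lms ⨾≤ writes ⨾≤
                   relax (loopTime-mono 3 Q-short) (output≤ _)
  in _ , t , p , result , t≤
  where
  ms = concat rows
  lms = length-concat rows eqs
  R₀ = initialR n
  C₀ = initialC n
  Q₀ = false ∷ trues (n * n) ++ false ∷ trues n ++ []

  start : Runs≤ parseOrder
    (store (unary n ++ ms ++ rest) [] [] [] [] [] [] [] [] [] [] [])
    (store (ms ++ rest) (trues n) [] (trues n) (trues n) [] [] [] [] [] []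
           (false ∷ trues n ++ []))
    (1 + loopTime (1 + n) 6)
  start = subst
    (λ N → Runs≤ parseOrder (store (unary n ++ ms ++ rest) [] [] [] [] [] [] [] [] [] [] [])
                            (store (ms ++ rest) N [] N N [] [] [] [] [] [] (false ∷ trues n ++ []))
                            (1 + loopTime (1 + n) 6))
    (++-identityʳ (trues n)) (parseOrder≤ n)

  R-long : length ms ≤ length R₀
  R-long = ≤-trans (≤-reflexive lms) (initialR-long n)

  C-long : length ms ≤ length C₀
  C-long = ≤-trans (≤-reflexive lms) (initialC-long n)

  Q-short : length (rowsFrom n n ms R₀ C₀ ʳ++ Q₀) ≤ outputLength n
  Q-short = begin
    length (rowsFrom n n ms R₀ C₀ ʳ++ Q₀)         ≡⟨ length-ʳ++ (rowsFrom n n ms R₀ C₀) ⟩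
    length (rowsFrom n n ms R₀ C₀) + length Q₀    ≤⟨ +-mono-≤ (length-rowsFrom n n ms R₀ C₀) (≤-reflexive Q₀-length) ⟩
    n * length ms + (1 + (n * n + (1 + n)))       ≡⟨ cong (λ l → n * l + (1 + (n * n + (1 + n)))) lms ⟩
    outputLength n                                ∎
    where
    open ≤-Reasoning
    Q₀-length : length Q₀ ≡ 1 + (n * n + (1 + n))
    Q₀-length = cong suc (trans (length-++-replicate (n * n) true _)
      (cong (λ l → n * n + suc l) (trans (length-++-replicate n true []) (+-identityʳ n))))

  result : (rowsFrom n n ms R₀ C₀ ʳ++ Q₀) ʳ++ rest ≡ expand n ms ++ rest
  result = begin
    (rows′ ʳ++ Q₀) ʳ++ rest                                        ≡⟨ ʳ++-ʳ++ rows′ ⟩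
    Q₀ ʳ++ (rows′ ++ rest)                                         ≡⟨ replicate-ʳ++ (n * n) true _ _ ⟩
    (trues n ++ []) ʳ++ (false ∷ trues (n * n) ++ false ∷ rows′ ++ rest) ≡⟨ replicate-ʳ++ n true [] _ ⟩
    trues n ++ false ∷ trues (n * n) ++ false ∷ rows′ ++ rest      ≡⟨ reassoc n _ ⟩
    unary n ++ trues (n * n) ++ false ∷ rows′ ++ rest              ≡⟨ cong (unary n ++_) (reassoc (n * n) _) ⟩
    unary n ++ unary (n * n) ++ rows′ ++ rest                      ≡⟨ cong (unary n ++_) (++-assoc (unary (n * n)) rows′ rest) ⟨
    unary n ++ (unary (n * n) ++ rows′) ++ rest                    ≡⟨ ++-assoc (unary n) _ rest ⟨
    expand n ms ++ rest                                            ∎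
    where
    open ≡-Reasoning
    rows′ = rowsFrom n n ms R₀ C₀
    reassoc : ∀ k xs → trues k ++ false ∷ xs ≡ unary k ++ xs
    reassoc k xs = sym (++-assoc (trues k) _ xs)

-- The masks produce the code of the subdivision

-- Column combine u v stands for the edge uv when v < u; the other columns are
-- isolated, or pendant at u when uv is an edge and u < v.
incident : ∀ {n} → EdgeSet n → Fin n → Fin n × Fin n → Bool
incident E x (u , v) = has E u v ∧ ((toℕ x ≡ᵇ toℕ u) ∨ ((toℕ x ≡ᵇ toℕ v) ∧ (toℕ v <ᵇ toℕ u)))

incidence : ∀ {n} → EdgeSet n → Fin n → Fin (n * n) → Bool
incidence {n} E x e = incident E x (remQuot n e)

-- Positions beyond the end read as `false`, so a word of `falses` reads `false` at every position.
bit : List Bool → ℕ → Bool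
bit []       _       = false
bit (x ∷ _)  zero    = x
bit (_ ∷ xs) (suc i) = bit xs i

bit-++ : ∀ k x xs i → bit (replicate k x ++ xs) (k + i) ≡ bit xs i
bit-++ zero    x xs i = refl
bit-++ (suc k) x xs i = bit-++ k x xs i

bit-replicate : ∀ {k i} x xs → i < k → bit (replicate k x ++ xs) i ≡ x
bit-replicate {suc k} {zero}  x xs _         = refl
bit-replicate {suc k} {suc i} x xs (s≤s i<k) = bit-replicate x xs i<k

bit-falses : ∀ k i → bit (falses k ++ []) i ≡ false
bit-falses zero    i       = refl
bit-falses (suc k) zero    = refl
bit-falses (suc k) (suc i) = bit-falses k i

iterate : ∀ {A : Set} → (A → A) → A → ℕ → A
iterate f x zero    = x
iterate f x (suc k) = f (iterate f x k)

iterate-suc : ∀ {A : Set} (f : A → A) x k → iterate f (f x) k ≡ f (iterate f x k)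
iterate-suc f x zero    = refl
iterate-suc f x (suc k) = cong f (iterate-suc f x k)

nextR nextC : ℕ → List Bool → List Bool
nextR n R = falses n ++ R
nextC n C = false ∷ falses n ++ C

rowMask columnMask : ℕ → ℕ → List Bool
rowMask    n = iterate (nextR n) (initialR n)
columnMask n = iterate (nextC n) (initialC n)

bit-rowMask : ∀ n x u v → v < n → bit (rowMask n x) (u * n + v) ≡ (x ≡ᵇ u)
bit-rowMask n zero zero v v<n = bit-replicate true _ v<n
bit-rowMask n zero (suc u) v v<n rewrite +-assoc n (u * n) v =
  trans (bit-++ n true _ _) (bit-falses (n * n) _)
bit-rowMask n (suc x) zero v v<n = bit-replicate false _ v<n
bit-rowMask n (suc x) (suc u) v v<n rewrite +-assoc n (u * n) v =
  trans (bit-++ n false _ _) (bit-rowMask n x u v v<n)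

bit-periods : ∀ n k u v → u < k → v < n →
  bit (concat (replicate k (period n)) ++ []) (u * n + v) ≡ (0 ≡ᵇ v)
bit-periods (suc n) (suc k) zero zero _ _ = refl
bit-periods (suc n) (suc k) zero (suc v) _ (s≤s v<n)
  rewrite ++-assoc (falses n) (concat (replicate k (period (suc n)))) [] =
  bit-replicate false _ v<n
bit-periods (suc n) (suc k) (suc u) v (s≤s u<k) v<n
  rewrite ++-assoc (falses n) (concat (replicate k (period (suc n)))) []
        | +-assoc n (u * suc n) v =
  trans (bit-++ n false _ _) (bit-periods (suc n) k u v u<k v<n)

-- Prefixing `n + 1` bits carries the bit of `(u , v)` to `(suc u , suc v)`, and both `x ≡ᵇ v` and
-- `v <ᵇ u` are unchanged when all three numbers grow by one. What remains is column 0, which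
-- receives either the new prefix or a bit that wraps around.
bit-columnMask : ∀ n x u v → u < n → v < n →
  bit (columnMask n x) (u * n + v) ≡ (x ≡ᵇ v) ∧ (v <ᵇ u)
bit-columnMask n zero zero v u<n v<n =
  trans (bit-replicate false _ v<n) (sym (∧-zeroʳ (0 ≡ᵇ v)))
bit-columnMask n zero (suc u) v u<n v<n rewrite +-assoc n (u * n) v =
  trans (bit-++ n false _ _) (trans (bit-periods n n u v (<-trans (n<1+n u) u<n) v<n) (lemma v))
  where
  lemma : ∀ v → (0 ≡ᵇ v) ≡ (0 ≡ᵇ v) ∧ (v <ᵇ suc u)
  lemma zero    = refl
  lemma (suc v) = refl
bit-columnMask n (suc x) zero zero u<n v<n = refl
bit-columnMask n (suc x) zero (suc v) u<n v<n =
  trans (bit-replicate false _ (<-trans (n<1+n v) v<n)) (sym (∧-zeroʳ (x ≡ᵇ v)))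
bit-columnMask (suc n) (suc x) (suc u) (suc v) u<n v<n
  rewrite +-assoc n (u * suc n) (suc v) | +-suc (u * suc n) v | +-suc n (u * suc n + v) =
  trans (bit-++ n false _ _) (bit-columnMask (suc n) x u v (<-trans (n<1+n u) u<n) (<-trans (n<1+n v) v<n))
bit-columnMask (suc n) (suc x) (suc zero) zero u<n v<n
  rewrite +-identityʳ (n + 0) | +-identityʳ n =
  bit-replicate false _ (n<1+n n)
-- The shift wraps the last column, of index `n`, of block `u` to column 0 of block `u + 2`. The
-- wrapped bit could be `true` only if `n < u`, which the bound on `u` excludes.
bit-columnMask (suc n) (suc x) (suc (suc u)) zero (s≤s u<n) v<n
  rewrite +-identityʳ (n + suc (n + u * suc n)) | +-suc n (n + u * suc n)
        | +-comm n (u * suc n) =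
  trans (bit-++ n false _ _) (trans (bit-columnMask (suc n) x u n (<-trans (n<1+n u) (m<n⇒m<1+n u<n)) (n<1+n n))
    (lemma (<⇒≱ (<-trans (n<1+n u) u<n))))
  where
  lemma : n ≰ u → (x ≡ᵇ n) ∧ (n <ᵇ u) ≡ false
  lemma n≰u with n <ᵇ u in eq
  ... | false = ∧-zeroʳ (x ≡ᵇ n)
  ... | true  = contradiction (<⇒≤ (<ᵇ⇒< n u (subst T (sym eq) _))) n≰u

masked-tabulate : ∀ {N} (f : Fin N → Bool) R C → N ≤ length R → N ≤ length C →
  let N′ = length (tabulate f) in
  masked (tabulate f) (take N′ R) (take N′ C) ≡
  tabulate (λ e → f e ∧ (bit R (toℕ e) ∨ bit C (toℕ e)))
masked-tabulate {zero}  f R       C       _         _         = refl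
masked-tabulate {suc N} f (r ∷ R) (c ∷ C) (s≤s R≥N) (s≤s C≥N) =
  cong (_ ∷_) (masked-tabulate (f ∘ suc) R C R≥N C≥N)

rowsFrom-tabulate : ∀ n k {N} (f : Fin N → Bool) R C → N ≤ length R → N ≤ length C →
  rowsFrom n k (tabulate f) R C ≡
  concat (tabulate {n = k} λ i → tabulate λ e →
    f e ∧ (bit (iterate (nextR n) R (toℕ i)) (toℕ e) ∨ bit (iterate (nextC n) C (toℕ i)) (toℕ e)))
rowsFrom-tabulate n zero    f R C R≥N C≥N = refl
rowsFrom-tabulate n (suc k) f R C R≥N C≥N = cong₂ _++_
  (masked-tabulate f R C R≥N C≥N)
  (trans (rowsFrom-tabulate n k f _ _ (longer R≥N) (m≤n⇒m≤1+n (longer C≥N)))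
    (cong concat (tabulate-cong {n = k} λ i → tabulate-cong λ e → cong (f e ∧_) (cong₂ _∨_
      (cong (λ w → bit w (toℕ e)) (iterate-suc (nextR n) R (toℕ i)))
      (cong (λ w → bit w (toℕ e)) (iterate-suc (nextC n) C (toℕ i)))))))
  where
  longer : ∀ {N xs} → N ≤ length xs → N ≤ length (falses n ++ xs)
  longer {xs = xs} N≤ = ≤-trans N≤ (≤-trans (m≤n+m _ _) (≤-reflexive (sym (length-++ (falses n)))))

tabulate-++ : ∀ {A : Set} m {n} (f : Fin (m + n) → A) →
  tabulate f ≡ tabulate (λ i → f (i ↑ˡ n)) ++ tabulate (λ j → f (m ↑ʳ j))
tabulate-++ zero    f = refl
tabulate-++ (suc m) f = cong (f zero ∷_) (tabulate-++ m (f ∘ suc))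

tabulate-combine : ∀ {A : Set} {m n} (f : Fin (m * n) → A) →
  tabulate f ≡ concat (tabulate {n = m} λ i → tabulate {n = n} λ j → f (combine i j))
tabulate-combine {m = zero}      f = refl
tabulate-combine {m = suc m} {n} f = trans (tabulate-++ n f)
  (cong (tabulate (λ j → f (j ↑ˡ (m * n))) ++_) (tabulate-combine {m = m} {n} (f ∘ (n ↑ʳ_))))

matrix-tabulate : ∀ {m n} (M : Fin m → Fin n → Bool) → matrix M ≡ concat (tabulate {n = m} λ i → tabulate {n = n} (M i))
matrix-tabulate {m} {n} M = cong concat (trans
  (map-tabulate {n = m} id (λ i → map (M i) (allFin n)))
  (tabulate-cong {n = m} λ i → map-tabulate {n = n} id (M i)))

matrix-flat : ∀ {m n} (M : Fin m → Fin n → Bool) → matrix M ≡ tabulate (uncurry M ∘ remQuot n)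
matrix-flat {m} {n} M = trans (matrix-tabulate M) (sym (trans (tabulate-combine {m = m} {n} (uncurry M ∘ remQuot n))
  (cong concat (tabulate-cong {n = m} λ i → tabulate-cong {n = n} λ j → cong (uncurry M) (Fin.remQuot-combine i j)))))

subdivision : ∀ {n} → EdgeSet n → BipartiteGraph
subdivision {n} E = record { t = n ; b = n * n ; adj = incidence E }

expand-matrix : ∀ {n} (E : EdgeSet n) → expand n (matrix (has E)) ≡ codeBipartite (subdivision E)
expand-matrix {n} E = cong (λ bits → unary n ++ unary (n * n) ++ bits) (begin
  rowsFrom n n (matrix (has E)) (initialR n) (initialC n)
    ≡⟨ cong (λ ms → rowsFrom n n ms (initialR n) (initialC n)) (matrix-flat (has E)) ⟩
  rowsFrom n n (tabulate (uncurry (has E) ∘ remQuot n)) (initialR n) (initialC n)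
    ≡⟨ rowsFrom-tabulate n n _ _ _ (initialR-long n) (initialC-long n) ⟩
  concat (tabulate {n = n} λ x → tabulate {n = n * n} λ e → uncurry (has E) (remQuot {n} n e) ∧
    (bit (rowMask n (toℕ x)) (toℕ e) ∨ bit (columnMask n (toℕ x)) (toℕ e)))
    ≡⟨ cong concat (tabulate-cong {n = n} λ x → tabulate-cong {n = n * n} λ e →
         cong (uncurry (has E) (remQuot {n} n e) ∧_) (mask x e)) ⟩
  concat (tabulate {n = n} λ x → tabulate {n = n * n} (incidence E x))
    ≡⟨ matrix-tabulate (incidence E) ⟨
  matrix (incidence E) ∎)
  where
  open ≡-Reasoning
  mask : ∀ x e → let (u , v) = remQuot {n} n e in
    bit (rowMask n (toℕ x)) (toℕ e) ∨ bit (columnMask n (toℕ x)) (toℕ e) ≡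
    (toℕ x ≡ᵇ toℕ u) ∨ ((toℕ x ≡ᵇ toℕ v) ∧ (toℕ v <ᵇ toℕ u))
  mask x e = let (u , v) = remQuot {n} n e in cong₂ _∨_
    (trans (cong (bit (rowMask n (toℕ x))) index) (bit-rowMask n (toℕ x) (toℕ u) (toℕ v) (Fin.toℕ<n v)))
    (trans (cong (bit (columnMask n (toℕ x))) index)
      (bit-columnMask n (toℕ x) (toℕ u) (toℕ v) (Fin.toℕ<n u) (Fin.toℕ<n v)))
    where
    index : let (u , v) = remQuot {n} n e in toℕ e ≡ toℕ u * n + toℕ v
    index = let (u , v) = remQuot {n} n e in begin
      toℕ e                ≡⟨ cong toℕ (Fin.combine-remQuot {n} n e) ⟨
      toℕ (combine u v)    ≡⟨ Fin.toℕ-combine u v ⟩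
      n * toℕ u + toℕ v    ≡⟨ cong (_+ toℕ v) (*-comm n (toℕ u)) ⟩
      toℕ u * n + toℕ v    ∎

module _ {A B : Set} {codeA : A → List Bool} {codeB : B → List Bool} {f : A → B}
  (order : A → ℕ) (edges : ∀ x → EdgeSet (order x)) (rest : A → List Bool)
  (codeA-≡ : ∀ x → codeA x ≡ unary (order x) ++ matrix (has (edges x)) ++ rest x)
  (codeB-≡ : ∀ x → codeB (f x) ≡ codeBipartite (subdivision (edges x)) ++ rest x) where

  expansion-polynomialTime : PolynomialTime codeA codeB f
  expansion-polynomialTime = record
    { r       = 11
    ; program = program
    ; c       = proj₁ programTime-bound
    ; d       = proj₁ (proj₂ programTime-bound)
    ; correct = λ x →
        let n = order x
            M = has (edges x)
            τ , t , runs , head-≡ , t≤ = program-correct n (rows M) (rest x) (rows-length M) (row-length M)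
        in τ , t
           , subst (λ input → Runs program (initial input) τ t) (sym (codeA-≡ x)) runs
           , trans head-≡ (trans (cong (_++ rest x) (expand-matrix (edges x))) (sym (codeB-≡ x)))
           , ≤-trans t≤ (Bounded.bound (proj₂ (proj₂ programTime-bound) _ (order≤ x)))
    }
    where
    rows : ∀ {n} → (Fin n → Fin n → Bool) → List (List Bool)
    rows {n} M = map (λ i → map (M i) (allFin n)) (allFin n)

    rows-length : ∀ {n} (M : Fin n → Fin n → Bool) → length (rows M) ≡ n
    rows-length {n} M = trans (length-map _ (allFin n)) (length-tabulate {n = n} id)

    row-length : ∀ {n} (M : Fin n → Fin n → Bool) → All (λ row → length row ≡ n) (rows M)
    row-length {n} M =
      All.map⁺ (All.universal (λ i → trans (length-map (M i) (allFin n)) (length-tabulate {n = n} id)) (allFin n))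

    -- The order is coded in unary, hence is at most the input length; this turns a polynomial in
    -- the order into a polynomial in the input length.
    order≤ : ∀ x → order x ≤ suc (length (codeA x))
    order≤ x = begin
      order x                             ≤⟨ m≤m+n _ _ ⟩
      order x + _                         ≡⟨ length-++-replicate (order x) true _ ⟨
      length (trues (order x) ++ false ∷ matrix (has (edges x)) ++ rest x)
        ≡⟨ cong length (++-assoc (trues (order x)) (false ∷ []) _) ⟨
      length (unary (order x) ++ matrix (has (edges x)) ++ rest x)    ≡⟨ cong length (codeA-≡ x) ⟨
      length (codeA x)                    ≤⟨ n≤1+n _ ⟩
      suc (length (codeA x))              ∎
      where open ≤-Reasoning

-- From a path decomposition to a linear forest

-- Ranks may coincide for vertices that are not adjacent. A cycle is excluded because its vertex of
-- highest rank would have two lower neighbors. Decidability of `up?` and `down?` allows a path to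
-- be followed upwards or downwards until it ends.
record Ranking (G : Graph) : Set where
  open Graph G using (_~_)
  field
    rank          : V G → ℕ
    height        : ℕ
    rank<height   : ∀ u → rank u < height
    up?           : ∀ u → Dec (∃[ v ] (u ~ v × rank u < rank v))
    down?         : ∀ u → Dec (∃[ v ] (u ~ v × rank v < rank u))
    rank-distinct : ∀ {u v} → u ~ v → rank u ≢ rank v
    up-unique     : ∀ {u v w} → u ~ v → u ~ w → rank u < rank v → rank u < rank w → v ≡ w
    down-unique   : ∀ {u v w} → u ~ v → u ~ w → rank v < rank u → rank w < rank u → v ≡ w

module _ {G : Graph} (ranking : Ranking G) where
  open Graph G using (_~_; ~-sym)
  open Ranking ranking

  data Ascent : V G → List (V G) → Set where
    stop : ∀ {u} → ¬ (∃[ v ] (u ~ v × rank u < rank v)) → Ascent u (u ∷ [])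
    step : ∀ {u v vs} → u ~ v → rank u < rank v → Ascent v vs → Ascent u (u ∷ vs)

  ascend : ∀ fuel u → height ≤ fuel + rank u → ∃[ us ] Ascent u us
  ascend zero       u h≤ = contradiction h≤ (<⇒≱ (rank<height u))
  ascend (suc fuel) u h≤ with up? u
  ... | no top = _ , stop top
  ... | yes (v , u~v , u<v) =
    let vs , asc = ascend fuel v (≤-trans h≤
                     (≤-trans (≤-reflexive (sym (+-suc fuel (rank u)))) (+-monoʳ-≤ fuel u<v)))
    in u ∷ vs , step u~v u<v asc

  descend : ∀ fuel u → rank u < fuel →
    ∃[ b ] (Star _~_ u b × ¬ (∃[ v ] (b ~ v × rank v < rank b)))
  descend (suc fuel) u u< with down? u
  ... | no bottom = u , ε , bottom
  ... | yes (v , u~v , v<u) =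
    let b , v→b , bottom = descend fuel v (<-≤-trans v<u (≤-pred u<)) in b , u~v ◅ v→b , bottom

  head∈ : ∀ {u us} → Ascent u us → u ∈ us
  head∈ (stop _)     = here refl
  head∈ (step _ _ _) = here refl

  head-least : ∀ {u us} → Ascent u us → All (λ v → rank u ≤ rank v) us
  head-least (stop _)         = ≤-refl ∷ []
  head-least (step _ u<v asc) = ≤-refl ∷ All.map (≤-trans (<⇒≤ u<v)) (head-least asc)

  ascent-unique : ∀ {u us} → Ascent u us → Unique us
  ascent-unique (stop _)         = [] ∷ []
  ascent-unique (step _ u<v asc) =
    All.map (λ v≤w u≡w → <⇒≢ (<-≤-trans u<v v≤w) (cong rank u≡w)) (head-least asc) ∷ ascent-unique asc

  ascent-connected : ∀ {u us w} → Ascent u us → w ∈ us → Star _~_ u w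
  ascent-connected (stop _)         (here refl) = ε
  ascent-connected (step _ _ _)     (here refl) = ε
  ascent-connected (step u~v _ asc) (there w∈)  = u~v ◅ ascent-connected asc w∈

  -- The unique upper neighbor of a listed vertex is the next entry and its unique lower neighbor is
  -- the previous one. The list can thus be left only from its first vertex, and only downwards.
  ascent-closed : ∀ {u us w x} → Ascent u us → w ∈ us → w ~ x → x ∈ us ⊎ (w ≡ u × rank x < rank u)
  ascent-closed {u} {x = x} (stop top) (here refl) u~x with <-cmp (rank u) (rank x)
  ... | tri< u<x _ _ = contradiction (x , u~x , u<x) top
  ... | tri≈ _ eq _  = contradiction eq (rank-distinct u~x)
  ... | tri> _ _ x<u = inj₂ (refl , x<u)
  ascent-closed {u} {x = x} (step u~v u<v asc) (here refl) u~x with <-cmp (rank u) (rank x)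
  ... | tri< u<x _ _ rewrite up-unique u~x u~v u<x u<v = inj₁ (there (head∈ asc))
  ... | tri≈ _ eq _  = contradiction eq (rank-distinct u~x)
  ... | tri> _ _ x<u = inj₂ (refl , x<u)
  ascent-closed (step u~v u<v asc) (there w∈) w~x with ascent-closed asc w∈ w~x
  ... | inj₁ x∈ = inj₁ (there x∈)
  ... | inj₂ (refl , x<v) = inj₁ (here (down-unique w~x (~-sym u~v) x<v u<v))

  successor-~ : ∀ {u us} → Ascent u us → ∀ i j → toℕ j ≡ suc (toℕ i) → List.lookup us i ~ List.lookup us j
  successor-~ (stop _)         zero    (suc ())      eq
  successor-~ (step u~v _ (stop _))     zero (suc zero) eq = u~v
  successor-~ (step u~v _ (step _ _ _)) zero (suc zero) eq = u~v
  successor-~ (step u~v _ asc) (suc i) (suc j) eq = successor-~ asc i j (suc-injective eq)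

  upper-successor : ∀ {u us x} → Ascent u us → ∀ i → List.lookup us i ~ x → rank (List.lookup us i) < rank x →
    ∃[ j ] (toℕ j ≡ suc (toℕ i) × List.lookup us j ≡ x)
  upper-successor (stop top) zero u~x u<x = contradiction (_ , u~x , u<x) top
  upper-successor (step u~v u<v (stop _))     zero u~x u<x = suc zero , refl , up-unique u~v u~x u<v u<x
  upper-successor (step u~v u<v (step _ _ _)) zero u~x u<x = suc zero , refl , up-unique u~v u~x u<v u<x
  upper-successor (step _ _ asc) (suc i) w~x w<x =
    let j , eq , lookup-≡ = upper-successor asc i w~x w<x in suc j , cong suc eq , lookup-≡

  linearForest : LinearForest G
  linearForest v =
    -- The ascent starts at a vertex `b` without a lower neighbor, so the only exit that
    -- `ascent-closed` allows is shut and the list is the whole component.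
    let b , v→b , bottom = descend (suc (rank v)) v ≤-refl
        us , asc = ascend height b (m≤m+n height (rank b))
    in length us , List.lookup us , lookup-injective (ascent-unique asc) _ _ ,
       (λ w → mk⇔ (λ v→w → let w∈ = closed bottom asc (head∈ asc) (reverse ~-sym v→b ◅◅ v→w)
                             in Any.index w∈ , sym (lookup-index w∈))
                  λ where (i , refl) → v→b ◅◅ ascent-connected asc (∈-lookup i)) ,
       λ i j → mk⇔ (adjacent⇒consecutive asc i j) (consecutive⇒adjacent asc i j)
    where
    closed : ∀ {b us w x} → ¬ (∃[ v ] (b ~ v × rank v < rank b)) → Ascent b us →
             w ∈ us → Star _~_ w x → x ∈ us
    closed bottom asc w∈ ε = w∈
    closed bottom asc w∈ (w~y ◅ y→x) with ascent-closed asc w∈ w~y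
    ... | inj₁ y∈ = closed bottom asc y∈ y→x
    ... | inj₂ (refl , y<b) = contradiction (_ , w~y , y<b) bottom

    consecutive⇒adjacent : ∀ {u us} → Ascent u us → ∀ i j → Consecutive G i j → List.lookup us i ~ List.lookup us j
    consecutive⇒adjacent asc i j (inj₁ eq) = successor-~ asc i j eq
    consecutive⇒adjacent asc i j (inj₂ eq) = ~-sym (successor-~ asc j i eq)

    upward : ∀ {u us} → Ascent u us → ∀ i j → List.lookup us i ~ List.lookup us j →
             rank (List.lookup us i) < rank (List.lookup us j) → toℕ j ≡ suc (toℕ i)
    upward asc i j i~j i<j =
      let k , eq , lookup-≡ = upper-successor asc i i~j i<j
      in trans (cong toℕ (sym (lookup-injective (ascent-unique asc) k j lookup-≡))) eq

    adjacent⇒consecutive : ∀ {u us} → Ascent u us → ∀ i j → List.lookup us i ~ List.lookup us j → Consecutive G i j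
    adjacent⇒consecutive {us = us} asc i j i~j with <-cmp (rank (List.lookup us i)) (rank (List.lookup us j))
    ... | tri< i<j _ _ = inj₁ (upward asc i j i~j i<j)
    ... | tri≈ _ eq _  = contradiction eq (rank-distinct i~j)
    ... | tri> _ _ j<i = inj₂ (upward asc j i (~-sym i~j) j<i)

three∉pair : ∀ {A : Set} {x y z : A} {xs : List A} → x ≢ y → x ≢ z → y ≢ z →
             x ∈ xs → y ∈ xs → z ∈ xs → ¬ length xs ≤ 2
three∉pair {xs = a ∷ []} x≢y _ _ (here refl) (here refl) _ _ = x≢y refl
three∉pair {xs = a ∷ b ∷ []} x≢y _ _ (here refl) (here refl) _ _ = x≢y refl
three∉pair {xs = a ∷ b ∷ []} _ x≢z _ (here refl) (there _) (here refl) _ = x≢z refl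
three∉pair {xs = a ∷ b ∷ []} _ _ y≢z (here refl) (there (here refl)) (there (here refl)) _ = y≢z refl
three∉pair {xs = a ∷ b ∷ []} _ _ y≢z (there _) (here refl) (here refl) _ = y≢z refl
three∉pair {xs = a ∷ b ∷ []} _ x≢z _ (there (here refl)) (here refl) (there (here refl)) _ = x≢z refl
three∉pair {xs = a ∷ b ∷ []} x≢y _ _ (there (here refl)) (there (here refl)) _ _ = x≢y refl
three∉pair {xs = a ∷ b ∷ c ∷ xs} _ _ _ _ _ _ (s≤s (s≤s ()))

module _ {K : Graph} (D : PathDecomposition K) (width≤1 : PathDecomposition.width D ℤ.≤ ℤ.+ 1) where
  open PathDecomposition D

  bag-small : ∀ i → length (X i) ≤ 2
  bag-small i = ≤-trans (All.lookup (xs≤max 0 (tabulate (length ∘ X))) (∈-tabulate⁺ {f = length ∘ X} i)) (max≤2 _ width≤1)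
    where
    max≤2 : ∀ m → m ⊖ 1 ℤ.≤ ℤ.+ 1 → m ≤ 2
    max≤2 zero                _             = z≤n
    max≤2 (suc zero)          _             = s≤s z≤n
    max≤2 (suc (suc zero))    _             = ≤-refl
    max≤2 (suc (suc (suc m))) (ℤ.+≤+ (s≤s ()))

  no-triple : ∀ {x y z i} → x ≢ y → x ≢ z → y ≢ z → x ∈ X i → y ∈ X i → ¬ (z ∈ X i)
  no-triple x≢y x≢z y≢z x∈ y∈ z∈ = three∉pair x≢y x≢z y≢z x∈ y∈ z∈ (bag-small _)

  -- The Helly property of intervals: the median of i, j and k lies in all three.
  no-triangle : ∀ {x y z i j k} → x ≢ y → x ≢ z → y ≢ z →
    x ∈ X i → y ∈ X i → x ∈ X j → z ∈ X j → y ∈ X k → ¬ (z ∈ X k)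
  no-triangle {x} {y} {z} {i} {j} {k} x≢y x≢z y≢z xi yi xj zj yk zk
    with ≤-total (toℕ i) (toℕ j) | ≤-total (toℕ j) (toℕ k) | ≤-total (toℕ i) (toℕ k)
  ... | inj₁ i≤j | inj₁ j≤k | _        = no-triple x≢y x≢z y≢z xj (convex i≤j j≤k yi yk) zj
  ... | inj₁ i≤j | inj₂ k≤j | inj₁ i≤k = no-triple x≢y x≢z y≢z (convex i≤k k≤j xi xj) yk zk
  ... | inj₁ i≤j | inj₂ k≤j | inj₂ k≤i = no-triple x≢y x≢z y≢z xi yi (convex k≤i i≤j zk zj)
  ... | inj₂ j≤i | inj₁ j≤k | inj₁ i≤k = no-triple x≢y x≢z y≢z xi yi (convex j≤i i≤k zj zk)
  ... | inj₂ j≤i | inj₁ j≤k | inj₂ k≤i = no-triple x≢y x≢z y≢z (convex j≤k k≤i xj xi) yk zk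
  ... | inj₂ j≤i | inj₂ k≤j | _        = no-triple x≢y x≢z y≢z xj (convex k≤j j≤i yk yi) zj

-- A copy of the subdivision of E inside K; midpoint e is the vertex subdividing e.
record SubdivisionIn {n} (E : EdgeSet n) (K : Graph) : Set where
  open Graph (graph E) using (_~_)
  open Graph K using () renaming (_~_ to _≈_)
  field
    corner            : Fin n → V K
    midpoint          : ∀ {u v} → u ~ v → V K
    corner-injective  : ∀ {u v} → corner u ≡ corner v → u ≡ v
    midpoint≢corner   : ∀ {u v} (e : u ~ v) w → midpoint e ≢ corner w
    midpoint-injective : ∀ {u v w} (e : u ~ v) (f : u ~ w) → midpoint e ≡ midpoint f → v ≡ w
    left              : ∀ {u v} (e : u ~ v) → midpoint e ≈ corner u
    right             : ∀ {u v} (e : u ~ v) → midpoint e ≈ corner v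

module _ {n} {E : EdgeSet n} {K : Graph} (H : SubdivisionIn E K) where
  open Graph (graph E) using (_~_; ~-irrefl; ~-sym)
  open SubdivisionIn H

  corner≢ : ∀ {u v} → u ~ v → corner u ≢ corner v
  corner≢ u~v eq with refl ← corner-injective eq = ~-irrefl u~v

  pathwidth≤1⇒linearForest : PathwidthAtMost K (ℤ.+ 1) → LinearForest (graph E)
  pathwidth≤1⇒linearForest (D , width≤1) = linearForest {G = graph E} record
    { rank          = rank
    ; height        = s
    ; rank<height   = λ u → Fin.toℕ<n (home u)
    ; up?           = λ u → Fin.any? λ v → T? (has E u v) ×-dec rank u <? rank v
    ; down?         = λ u → Fin.any? λ v → T? (has E u v) ×-dec rank v <? rank u
    ; rank-distinct = λ {u} {v} u~v eq → disjoint u~v (home∈ u)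
                        (subst (λ i → corner v ∈ X i) (sym (Fin.toℕ-injective eq)) (home∈ v))
    ; up-unique     = up-unique
    ; down-unique   = down-unique
    }
    where
    open PathDecomposition D

    home : Fin n → Fin s
    home u = proj₁ (coverVertex (corner u))

    home∈ : ∀ u → corner u ∈ X (home u)
    home∈ u = proj₂ (coverVertex (corner u))

    rank : Fin n → ℕ
    rank u = toℕ (home u)

    disjoint : ∀ {u v i} → u ~ v → corner u ∈ X i → ¬ (corner v ∈ X i)
    disjoint {u} {v} u~v ui vi =
      let j , ej , uj = coverEdge (left u~v)
          k , ek , vk = coverEdge (right u~v)
      in no-triangle D width≤1 (corner≢ u~v) (midpoint≢corner u~v u ∘ sym) (midpoint≢corner u~v v ∘ sym)
           ui vi uj ej vk ek

    -- The bags of `u` and the bags of `v` form disjoint intervals, so one pair of bags decides the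
    -- order of all pairs. Hence the order of the ranks of neighbors does not depend on the bags
    -- picked by `home`.
    before : ∀ {u v} → u ~ v → rank u < rank v → ∀ {i j} → corner u ∈ X i → corner v ∈ X j → i Fin.< j
    before {u} {v} u~v u<v {i} {j} ui vj with <-cmp (toℕ i) (toℕ j)
    ... | tri< i<j _ _ = i<j
    ... | tri≈ _ eq _  = contradiction (subst (λ k → corner v ∈ X k) (sym (Fin.toℕ-injective eq)) vj) (disjoint u~v ui)
    ... | tri> _ _ j<i with ≤-total (toℕ j) (rank u)
    ...   | inj₁ j≤u = contradiction (convex j≤u (<⇒≤ u<v) vj (home∈ v)) (disjoint u~v (home∈ u))
    ...   | inj₂ u≤j = contradiction vj (disjoint u~v (convex u≤j (<⇒≤ j<i) (home∈ u) ui))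

    clash : ∀ {u v w k} (e : u ~ v) (f : u ~ w) → v ≢ w →
            corner u ∈ X k → midpoint e ∈ X k → ¬ (midpoint f ∈ X k)
    clash {u} e f v≢w = no-triple D width≤1 (midpoint≢corner e u ∘ sym) (midpoint≢corner f u ∘ sym)
                          (v≢w ∘ midpoint-injective e f)

    -- Say the bag j of u and midpoint f lies beyond the bag i of u and midpoint e: then midpoint e is in bag j too.
    up-unique : ∀ {u v w} → u ~ v → u ~ w → rank u < rank v → rank u < rank w → v ≡ w
    up-unique {u} {v} {w} e f u<v u<w with v Fin.≟ w
    ... | yes v≡w = v≡w
    ... | no v≢w =
      let i , ei , ui = coverEdge (left e)
          i′ , ei′ , vi′ = coverEdge (right e)
          j , fj , uj = coverEdge (left f)
          j′ , fj′ , wj′ = coverEdge (right f)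
      in [ (λ i≤j → contradiction fj (clash e f v≢w uj (convex i≤j (<⇒≤ (before e u<v uj vi′)) ei ei′)))
         , (λ j≤i → contradiction (convex j≤i (<⇒≤ (before f u<w ui wj′)) fj fj′) (clash e f v≢w ui ei))
         ]′ (≤-total (toℕ i) (toℕ j))

    -- The mirror image: both midpoints now have bags to the left of those of `u`, so the earlier of
    -- the bags `i` and `j` contains `u` and both midpoints.
    down-unique : ∀ {u v w} → u ~ v → u ~ w → rank v < rank u → rank w < rank u → v ≡ w
    down-unique {u} {v} {w} e f v<u w<u with v Fin.≟ w
    ... | yes v≡w = v≡w
    ... | no v≢w =
      let i , ei , ui = coverEdge (left e)
          i′ , ei′ , vi′ = coverEdge (right e)
          j , fj , uj = coverEdge (left f)
          j′ , fj′ , wj′ = coverEdge (right f)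
      in [ (λ i≤j → contradiction (convex (<⇒≤ (before (~-sym f) w<u wj′ ui)) i≤j fj′ fj) (clash e f v≢w ui ei))
         , (λ j≤i → contradiction fj (clash e f v≢w uj (convex (<⇒≤ (before (~-sym e) v<u vi′ uj)) j≤i ei′ ei)))
         ]′ (≤-total (toℕ i) (toℕ j))

-- From a linear forest to a path decomposition

record Arrangement {n} (E : EdgeSet n) : Set where
  open Graph (graph E) using (_~_)
  field
    position             : Fin n → ℕ
    position-injective   : ∀ {u v} → position u ≡ position v → u ≡ v
    extent               : ℕ
    position<extent      : ∀ u → position u < extent
    position-consecutive : ∀ {u v} → u ~ v → position v ≡ suc (position u) ⊎ position u ≡ suc (position v)

-- A vertex v is placed by its index on the path of the first vertex of its component, where each
-- component has a block of n positions.
linearForest⇒arrangement : ∀ {n} {E : EdgeSet n} → LinearForest (graph E) → Arrangement E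
linearForest⇒arrangement {n} {E} forest = record
  { position             = λ v → toℕ (place v)
  ; position-injective   = λ {u} {v} eq →
      let first-≡ , index-≡ = Fin.combine-injective (first u) (spot u) (first v) (spot v) (Fin.toℕ-injective eq)
      in same-place first-≡ (trans (sym (spot-index u)) (trans (cong toℕ index-≡) (spot-index v)))
           (proj₂ (first-on u)) (proj₂ (first-on v))
  ; extent               = n * n
  ; position<extent      = λ v → Fin.toℕ<n (place v)
  ; position-consecutive = λ {u} {v} u~v →
      Sum.map (next u v (first-~ u~v)) (next v u (sym (first-~ u~v)))
              (consecutive (first-~ u~v) u~v (proj₂ (first-on u)) (proj₂ (first-on v)))
  }
  where
  open Graph (graph E) using (_~_; ~-sym)

  size : Fin n → ℕ
  size u = proj₁ (forest u)

  path : ∀ u → Fin (size u) → Fin n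
  path u = proj₁ (proj₂ (forest u))

  _on_ : Fin n → Fin n → Set
  v on u = ∃[ i ] path u i ≡ v

  on? : ∀ v u → Dec (v on u)
  on? v u = Fin.any? λ i → path u i Fin.≟ v

  on⇒reachable : ∀ {u v} → v on u → Star _~_ u v
  on⇒reachable {u} {v} = Equivalence.from (proj₁ (proj₂ (proj₂ (proj₂ (forest u)))) v)

  reachable⇒on : ∀ {u v} → Star _~_ u v → v on u
  reachable⇒on {u} {v} = Equivalence.to (proj₁ (proj₂ (proj₂ (proj₂ (forest u)))) v)

  on-~ : ∀ {u v w} → v ~ w → v on u → w on u
  on-~ v~w v-on = reachable⇒on (on⇒reachable v-on ◅◅ v~w ◅ ε)

  -- The paths given for two vertices of one component may run in opposite directions, so all
  -- vertices of the component have to read their index off the same path. The list of candidates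
  -- depends only on the component, and its head is the canonical choice.
  roots : Fin n → List (Fin n)
  roots v = filter (on? v) (allFin n)

  -- The default only makes the function total: `roots v` contains `v`.
  headOr : Fin n → List (Fin n) → Fin n
  headOr v []      = v
  headOr v (u ∷ _) = u

  headOr-∈ : ∀ {v us} → v ∈ us → headOr v us ∈ us
  headOr-∈ {us = u ∷ us} _ = here refl

  headOr-irrelevant : ∀ {v w us} → v ∈ us → headOr v us ≡ headOr w us
  headOr-irrelevant {us = u ∷ us} _ = refl

  self∈roots : ∀ v → v ∈ roots v
  self∈roots v = ∈-filter⁺ (on? v) (∈-allFin v) (reachable⇒on ε)

  first : Fin n → Fin n
  first v = headOr v (roots v)

  first-on : ∀ v → v on first v
  first-on v = proj₂ (∈-filter⁻ (on? v) {xs = allFin n} (headOr-∈ (self∈roots v)))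

  first-~ : ∀ {v w} → v ~ w → first v ≡ first w
  first-~ {v} {w} v~w = trans (headOr-irrelevant (self∈roots v))
    (cong (headOr w) (filter-≐ (on? v) (on? w) (on-~ v~w , on-~ (~-sym v~w)) (allFin n)))

  -- A path is an injection into `Fin n`, so its indices fit into a block of length `n`.
  spot : Fin n → Fin n
  spot v = inject≤ (proj₁ (first-on v)) (Fin.injective⇒≤ (proj₁ (proj₂ (proj₂ (forest (first v))))))

  spot-index : ∀ v → toℕ (spot v) ≡ toℕ (proj₁ (first-on v))
  spot-index v = Fin.toℕ-inject≤ _ _

  place : Fin n → Fin (n * n)
  place v = combine (first v) (spot v)

  same-place : ∀ {a b u v} → a ≡ b → {i : Fin (size a)} {j : Fin (size b)} → toℕ i ≡ toℕ j →
               path a i ≡ u → path b j ≡ v → u ≡ v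
  same-place refl eq refl refl rewrite Fin.toℕ-injective eq = refl

  consecutive : ∀ {a b u v} → a ≡ b → u ~ v → {i : Fin (size a)} {j : Fin (size b)} →
                path a i ≡ u → path b j ≡ v → toℕ j ≡ suc (toℕ i) ⊎ toℕ i ≡ suc (toℕ j)
  consecutive {a} refl u~v {i} {j} refl refl =
    Equivalence.to (proj₂ (proj₂ (proj₂ (proj₂ (forest a)))) i j) u~v

  next : ∀ u v → first u ≡ first v → toℕ (proj₁ (first-on v)) ≡ suc (toℕ (proj₁ (first-on u))) →
         toℕ (place v) ≡ suc (toℕ (place u))
  next u v first-≡ eq = begin
    toℕ (place v)                              ≡⟨ Fin.toℕ-combine (first v) (spot v) ⟩
    n * toℕ (first v) + toℕ (spot v)           ≡⟨ cong₂ (λ a i → n * toℕ a + i) (sym first-≡)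
                                                    (trans (spot-index v) (trans eq (cong suc (sym (spot-index u))))) ⟩
    n * toℕ (first u) + suc (toℕ (spot u))     ≡⟨ +-suc _ _ ⟩
    suc (n * toℕ (first u) + toℕ (spot u))     ≡⟨ cong suc (Fin.toℕ-combine (first u) (spot u)) ⟨
    suc (toℕ (place u))                        ∎
    where open ≡-Reasoning

-- Caterpillar layouts and their path decompositions

-- top p is the spine vertex at position p, pendant p a leaf at (or an isolated vertex near) position p,
-- and link p the spine vertex between top p and top (suc p).
data Kind : Set where
  top pendant link : ℕ → Kind
  exploded         : Kind

isTop : Kind → Bool
isTop (top _) = true
isTop _       = false

-- The last position whose block of bags the vertex enters. An `exploded` vertex enters none; its
-- value 0 lies below the extent as soon as some position does.
reach : Kind → ℕ
reach (top p)     = p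
reach (pendant p) = p
reach (link p)    = suc p
reach exploded    = 0

data Attached : ℕ → Kind → Set where
  leaf  : ∀ {p} → Attached p (pendant p)
  left  : ∀ {p} → Attached p (link p)
  right : ∀ {p} → Attached (suc p) (link p)
  gone  : ∀ {p} → Attached p exploded

-- Exactly the data that a single explosion preserves and that suffices for a decomposition once no
-- vertex is `exploded`. Decidable adjacency serves to list the pendants of an explosion and to
-- recover the irrelevant adjacency proof stored in a pendant.
record Layout (G : Graph) (extent : ℕ) : Set where
  open Graph G using (_~_)
  field
    vertices       : List (V G)
    complete       : ∀ v → v ∈ vertices
    _≟_            : DecidableEquality (V G)
    _~?_           : ∀ u v → Dec (u ~ v)
    kind           : V G → Kind
    within         : ∀ v → reach (kind v) < extent
    top-injective  : ∀ {u v p} → kind u ≡ top p → kind v ≡ top p → u ≡ v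
    link-injective : ∀ {u v p} → kind u ≡ link p → kind v ≡ link p → u ≡ v
    edge           : ∀ {u v} → u ~ v → (∃[ p ] (kind u ≡ top p × Attached p (kind v))) ⊎
                                       (∃[ p ] (kind v ≡ top p × Attached p (kind u)))

vertex-≡ : ∀ G {v} {x y : Survivor G v} → _≡_ {A = Survivor G v ⊎ Pendant G v} (inj₁ x) (inj₁ y) →
           Survivor.vertex x ≡ Survivor.vertex y
vertex-≡ G refl = refl

support-≡ : ∀ G {v} {p q : Pendant G v} → _≡_ {A = Survivor G v ⊎ Pendant G v} (inj₂ p) (inj₂ q) →
            Pendant.support p ≡ Pendant.support q
support-≡ G refl = refl

module _ {G : Graph} {extent} (layout : Layout G extent) (v : V G) where
  open Graph G using (_~_)
  open Layout layout

  explode-layout : kind v ≡ exploded → Layout (explode G v) extent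
  explode-layout gone-v = record
    { vertices       = concatMap copies vertices
    ; complete       = complete′
    ; _≟_            = _≟′_
    ; _~?_           = _~?′_
    ; kind           = kind′
    ; within         = λ where
        (inj₁ w) → within (Survivor.vertex w)
        (inj₂ q) → within (Pendant.support q)
    ; top-injective  = top-unique
    ; link-injective = link-unique
    ; edge           = λ {x} {y} → edge′ x y
    }
    where
    survivor-≡ : ∀ {x y : Survivor G v} → Survivor.vertex x ≡ Survivor.vertex y →
                 _≡_ {A = V (explode G v)} (inj₁ x) (inj₁ y)
    survivor-≡ refl = refl

    pendant-≡ : ∀ {p q : Pendant G v} → Pendant.support p ≡ Pendant.support q →
                _≡_ {A = V (explode G v)} (inj₂ p) (inj₂ q)
    pendant-≡ refl = refl

    kind′ : V (explode G v) → Kind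
    kind′ (inj₁ w) = kind (Survivor.vertex w)
    -- The support is a neighbor of an exploded vertex, so by `edge` it has some kind `top p`, whose
    -- `reach` is `p`. With `reach` in place of `p` the field `within` is inherited directly from
    -- the support.
    kind′ (inj₂ q) = pendant (reach (kind (Pendant.support q)))

    survivors pendants copies : V G → List (V (explode G v))
    survivors w with w ≟ v
    ... | yes _  = []
    ... | no w≢v = inj₁ (survivor w w≢v) ∷ []
    pendants w with v ~? w
    ... | yes v~w = inj₂ (pendant w v~w) ∷ []
    ... | no _    = []
    copies w = survivors w ++ pendants w

    survivor∈ : ∀ x → inj₁ x ∈ survivors (Survivor.vertex x)
    survivor∈ (survivor w w≢v) with w ≟ v
    ... | yes w≡v = ⊥-elim-irr (w≢v w≡v)
    ... | no _    = here refl

    pendant∈ : ∀ q → inj₂ q ∈ pendants (Pendant.support q)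
    pendant∈ (pendant w v~w) with v ~? w
    ... | yes _  = here refl
    ... | no v≁w = ⊥-elim-irr (v≁w v~w)

    complete′ : ∀ x → x ∈ concatMap copies vertices
    complete′ (inj₁ x) =
      ∈-concatMap⁺ copies (lose (complete (Survivor.vertex x)) (∈-++⁺ˡ (survivor∈ x)))
    complete′ (inj₂ q) =
      ∈-concatMap⁺ copies (lose (complete (Pendant.support q))
        (∈-++⁺ʳ (survivors (Pendant.support q)) (pendant∈ q)))

    _≟′_ : DecidableEquality (V (explode G v))
    inj₁ x ≟′ inj₁ y = map′ survivor-≡ (vertex-≡ G) (Survivor.vertex x ≟ Survivor.vertex y)
    inj₂ p ≟′ inj₂ q = map′ pendant-≡ (support-≡ G) (Pendant.support p ≟ Pendant.support q)
    inj₁ _ ≟′ inj₂ _ = no λ ()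
    inj₂ _ ≟′ inj₁ _ = no λ ()

    _~?′_ : ∀ x y → Dec (ExplodedAdj G v x y)
    inj₁ x ~?′ inj₁ y = Survivor.vertex x ~? Survivor.vertex y
    inj₁ x ~?′ inj₂ q = Survivor.vertex x ≟ Pendant.support q
    inj₂ q ~?′ inj₁ x = Survivor.vertex x ≟ Pendant.support q
    inj₂ _ ~?′ inj₂ _ = no λ ()

    attached : ∀ q → ∃[ p ] (kind (Pendant.support q) ≡ top p × Attached p (kind′ (inj₂ q)))
    attached (pendant w v~w) with edge (recompute (v ~? w) v~w)
    ... | inj₁ (p , eq , _) with () ← trans (sym gone-v) eq
    ... | inj₂ (p , eq , _) rewrite eq = p , refl , leaf

    top-unique : ∀ {x y p} → kind′ x ≡ top p → kind′ y ≡ top p → x ≡ y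
    top-unique {inj₁ _} {inj₁ _} eq eq′ = survivor-≡ (top-injective eq eq′)

    link-unique : ∀ {x y p} → kind′ x ≡ link p → kind′ y ≡ link p → x ≡ y
    link-unique {inj₁ _} {inj₁ _} eq eq′ = survivor-≡ (link-injective eq eq′)

    edge′ : ∀ x y → ExplodedAdj G v x y → (∃[ p ] (kind′ x ≡ top p × Attached p (kind′ y))) ⊎
                                          (∃[ p ] (kind′ y ≡ top p × Attached p (kind′ x)))
    edge′ (inj₁ _) (inj₁ _) e    = edge e
    edge′ (inj₁ _) (inj₂ q) refl = inj₁ (attached q)
    edge′ (inj₂ q) (inj₁ _) refl = inj₂ (attached q)

-- Used with `isTop` as the class: a bag of the decomposition holds at most one vertex of kind `top`
-- and at most one other vertex.
two-classes : ∀ {A : Set} (class : A → Bool) {xs : List A} → Unique xs →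
  (∀ {x y} → x ∈ xs → y ∈ xs → class x ≡ class y → x ≡ y) → length xs ≤ 2
two-classes class {[]}         _ _ = z≤n
two-classes class {_ ∷ []}     _ _ = s≤s z≤n
two-classes class {_ ∷ _ ∷ []} _ _ = ≤-refl
two-classes class {x ∷ y ∷ z ∷ _} ((x≢y ∷ x≢z ∷ _) ∷ (y≢z ∷ _) ∷ _) same
  with class x in cx | class y in cy | class z in cz
... | true  | true  | _     = contradiction (same (here refl) (there (here refl)) (trans cx (sym cy))) x≢y
... | false | false | _     = contradiction (same (here refl) (there (here refl)) (trans cx (sym cy))) x≢y
... | true  | false | true  = contradiction (same (here refl) (there (there (here refl))) (trans cx (sym cz))) x≢z
... | false | true  | false = contradiction (same (here refl) (there (there (here refl))) (trans cx (sym cz))) x≢z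
... | true  | false | false = contradiction (same (there (here refl)) (there (there (here refl))) (trans cy (sym cz))) y≢z
... | false | true  | true  = contradiction (same (there (here refl)) (there (there (here refl))) (trans cy (sym cz))) y≢z

module _ {G : Graph} {extent} (layout : Layout G extent)
         (intact : ∀ v → Layout.kind layout v ≢ exploded) where
  open Graph G using (_~_)
  open Layout layout

  -- Each entry of `vertices` has a time of its own in every block; the two additional times, at the
  -- ends of the block, belong to the links to the previous and to the next spine vertex.
  slots W : ℕ
  slots = length vertices
  W = suc (suc slots)

  slot : V G → ℕ
  slot v = toℕ (Any.index (complete v))

  slot<slots : ∀ v → slot v < slots
  slot<slots v = Fin.toℕ<n (Any.index (complete v))

  slot-injective : ∀ {u v} → slot u ≡ slot v → u ≡ v
  slot-injective {u} {v} eq = trans (lookup-index (complete u))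
    (trans (cong (List.lookup vertices) (Fin.toℕ-injective eq)) (sym (lookup-index (complete v))))

  time : ℕ → ℕ → ℕ
  time p j = j + p * W

  time-/ : ∀ p {j} → j < W → time p j / W ≡ p
  time-/ p {j} j<W = trans (+-distrib-/-∣ʳ j (divides p refl)) (cong₂ _+_ (m<n⇒m/n≡0 j<W) (m*n/n≡m p W))

  time-% : ∀ p {j} → j < W → time p j % W ≡ j
  time-% p {j} j<W = trans ([m+kn]%n≡m%n j p W) (m<n⇒m%n≡m j<W)

  time-injective : ∀ {p q i j} → i < W → j < W → time p i ≡ time q j → p ≡ q × i ≡ j
  time-injective {p} {q} i<W j<W eq =
    trans (sym (time-/ p i<W)) (trans (cong (_/ W) eq) (time-/ q j<W)) ,
    trans (sym (time-% p i<W)) (trans (cong (_% W) eq) (time-% q j<W))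

  time-< : ∀ {p j} → p < extent → j < W → time p j < extent * W
  time-< {p} {j} p< j< = <-≤-trans (+-monoˡ-< (p * W) j<) (*-monoˡ-≤ W p<)

  early : ∀ v → suc (slot v) < W
  early v = s≤s (m<n⇒m<1+n (slot<slots v))

  -- Within the block of W times of position p, time 0 is for link (p ∸ 1) and the last time for link p,
  -- while each leaf has a time of its own in between.
  Alive : Kind → ℕ → ℕ → Set
  Alive (top p)     s t = t / W ≡ p
  Alive (pendant p) s t = t ≡ time p (suc s)
  Alive (link p)    s t = t ≡ time p (suc slots) ⊎ t ≡ time (suc p) 0
  Alive exploded    s t = ⊥

  alive? : ∀ k s t → Dec (Alive k s t)
  alive? (top p)     s t = t / W ℕ.≟ p
  alive? (pendant p) s t = t ℕ.≟ time p (suc s)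
  alive? (link p)    s t = (t ℕ.≟ time p (suc slots)) ⊎-dec (t ℕ.≟ time (suc p) 0)
  alive? exploded    s t = no λ ()

  -- A time determines its block and its offset. The block determines the `top`. Among the other
  -- kinds, the offsets 0 and `suc slots` occur only for links, where the block determines the link,
  -- and any offset in between belongs to the single leaf with that slot.
  alive-unique : ∀ {u v t} → Alive (kind u) (slot u) t → Alive (kind v) (slot v) t →
                 isTop (kind u) ≡ isTop (kind v) → u ≡ v
  alive-unique {u} {v} au av same with kind u in ku | kind v in kv
  ... | top p     | top q     = top-injective ku (trans kv (cong top (trans (sym av) au)))
  ... | pendant p | pendant q =
    slot-injective (suc-injective (proj₂ (time-injective {p} {q} (early u) (early v) (trans (sym au) av))))
  ... | pendant p | link q with av
  ...   | inj₁ eq =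
    contradiction (suc-injective (proj₂ (time-injective {p} {q} (early u) ≤-refl (trans (sym au) eq)))) (<⇒≢ (slot<slots u))
  ...   | inj₂ eq with () ← proj₂ (time-injective {p} {suc q} (early u) z<s (trans (sym au) eq))
  alive-unique {u} {v} au av same | link p    | pendant q with au
  ...   | inj₁ eq =
    contradiction (suc-injective (proj₂ (time-injective {q} {p} (early v) ≤-refl (trans (sym av) eq)))) (<⇒≢ (slot<slots v))
  ...   | inj₂ eq with () ← proj₂ (time-injective {q} {suc p} (early v) z<s (trans (sym av) eq))
  alive-unique {u} {v} au av same | link p    | link q with au | av
  ...   | inj₁ eq | inj₁ eq′ =
    link-injective ku (trans kv (cong link (proj₁ (time-injective {q} {p} ≤-refl ≤-refl (trans (sym eq′) eq)))))
  ...   | inj₂ eq | inj₂ eq′ =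
    link-injective ku (trans kv (cong link (suc-injective (proj₁ (time-injective {suc q} {suc p} z<s z<s (trans (sym eq′) eq))))))
  ...   | inj₁ eq | inj₂ eq′ with () ← proj₂ (time-injective {p} {suc q} ≤-refl z<s (trans (sym eq) eq′))
  alive-unique {u} {v} au av same | link p    | link q
        | inj₂ eq | inj₁ eq′ with () ← proj₂ (time-injective {q} {suc p} ≤-refl z<s (trans (sym eq′) eq))

  -- The blocks are contiguous, and the two times of a link are adjacent: `time (suc p) 0` is by
  -- definition the successor of `time p (suc slots)`.
  alive-convex : ∀ k s {i l j} → i ≤ l → l ≤ j → Alive k s i → Alive k s j → Alive k s l
  alive-convex (top p)     s i≤l l≤j refl aj = ≤-antisym (≤-trans (/-monoˡ-≤ W l≤j) (≤-reflexive aj)) (/-monoˡ-≤ W i≤l)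
  alive-convex (pendant p) s i≤l l≤j refl refl = ≤-antisym l≤j i≤l
  alive-convex (link p)    s i≤l l≤j (inj₁ refl) (inj₁ refl) = inj₁ (≤-antisym l≤j i≤l)
  alive-convex (link p)    s i≤l l≤j (inj₂ refl) (inj₂ refl) = inj₂ (≤-antisym l≤j i≤l)
  alive-convex (link p)    s i≤l l≤j (inj₂ refl) (inj₁ refl) = contradiction (≤-trans i≤l l≤j) (<⇒≱ ≤-refl)
  alive-convex (link p)    s {l = l} i≤l l≤j (inj₁ refl) (inj₂ refl) with m≤n⇒m<n∨m≡n l≤j
  ... | inj₁ l<j = inj₁ (≤-antisym (≤-pred l<j) i≤l)
  ... | inj₂ l≡j = inj₂ l≡j

  bag : ℕ → List (V G)
  bag t = filter (λ v → alive? (kind v) (slot v) t) (deduplicate _≟_ vertices)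

  alive⇒∈ : ∀ {v t} → Alive (kind v) (slot v) t → v ∈ bag t
  alive⇒∈ {v} {t} = ∈-filter⁺ (λ v → alive? (kind v) (slot v) t) (∈-deduplicate⁺ _≟_ (complete v))

  ∈⇒alive : ∀ {v t} → v ∈ bag t → Alive (kind v) (slot v) t
  ∈⇒alive {t = t} v∈ = proj₂ (∈-filter⁻ (λ v → alive? (kind v) (slot v) t) {xs = deduplicate _≟_ vertices} v∈)

  bag-unique : ∀ t → Unique (bag t)
  bag-unique t = Unique.filter⁺ (λ v → alive? (kind v) (slot v) t) (DecUnique.deduplicate-! _≟_ vertices)

  alive-somewhere : ∀ v → ∃[ t ] (t < extent * W × Alive (kind v) (slot v) t)
  alive-somewhere v with kind v in kv | within v
  ... | top p     | p< = time p 0 , time-< p< z<s , time-/ p z<s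
  ... | pendant p | p< = time p (suc (slot v)) , time-< p< (early v) , refl
  ... | link p    | p< = time (suc p) 0 , time-< p< z<s , inj₂ refl
  ... | exploded  | _  = contradiction kv (intact v)

  meet : ∀ {u v p} → kind u ≡ top p → Attached p (kind v) →
         ∃[ t ] (t < extent * W × Alive (kind u) (slot u) t × Alive (kind v) (slot v) t)
  meet {u} {v} {p} ku a with kind v in kv | within u
  ... | k | u< rewrite ku with a
  ...   | leaf  = time p (suc (slot v)) , time-< u< (early v) , time-/ p (early v) , refl
  ...   | left  = time p (suc slots) , time-< u< ≤-refl , time-/ p ≤-refl , inj₁ refl
  ...   | right = time p 0 , time-< u< z<s , time-/ p z<s , inj₂ refl
  ...   | gone  = contradiction kv (intact v)

  decomposition : PathDecomposition G
  decomposition = record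
    { s           = extent * W
    ; X           = bag ∘ toℕ
    ; unique      = bag-unique ∘ toℕ
    ; coverVertex = λ v → let t , t< , a = alive-somewhere v in fromℕ< t< , at t< (alive⇒∈ a)
    ; coverEdge   = coverEdge
    ; convex      = λ {_} {_} {_} {v} i≤l l≤j v∈i v∈j →
        alive⇒∈ (alive-convex (kind v) (slot v) i≤l l≤j (∈⇒alive v∈i) (∈⇒alive v∈j))
    }
    where
    at : ∀ {v t} (t< : t < extent * W) → v ∈ bag t → v ∈ bag (toℕ (fromℕ< t<))
    at t< = subst (λ t → _ ∈ bag t) (sym (Fin.toℕ-fromℕ< t<))

    coverEdge : ∀ {u v} → u ~ v → ∃[ i ] (u ∈ bag (toℕ i) × v ∈ bag (toℕ i))
    coverEdge {u} {v} u~v with edge u~v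
    ... | inj₁ (p , ku , a) =
      let t , t< , au , av = meet {u} {v} ku a in fromℕ< t< , at t< (alive⇒∈ au) , at t< (alive⇒∈ av)
    ... | inj₂ (p , kv , a) =
      let t , t< , av , au = meet {v} {u} kv a in fromℕ< t< , at t< (alive⇒∈ au) , at t< (alive⇒∈ av)

  pathwidth≤1 : PathwidthAtMost G (ℤ.+ 1)
  pathwidth≤1 = decomposition , small (max≤v⁺ z≤n (All.tabulate⁺ {n = extent * W} λ i →
    two-classes (isTop ∘ kind) (bag-unique (toℕ i)) λ u∈ v∈ → alive-unique (∈⇒alive u∈) (∈⇒alive v∈)))
    where
    small : ∀ {m} → m ≤ 2 → m ⊖ 1 ℤ.≤ ℤ.+ 1
    small z≤n             = ℤ.-≤+
    small (s≤s z≤n)       = ℤ.+≤+ z≤n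
    small (s≤s (s≤s z≤n)) = ℤ.+≤+ ≤-refl

-- `f` enumerates exactly the vertices of kind `exploded`. An explosion removes one of them from
-- both sides, and the vertices it creates are of kind `pendant`; when `f` is exhausted, every
-- vertex has a place in the decomposition.
layout⇒pathwidth≤1 : ∀ n {G extent} (layout : Layout G extent) (f : Fin n → V G) (inj : Injective _≡_ _≡_ f) →
  let kind = Layout.kind layout in
  (∀ i → kind (f i) ≡ exploded) → (∀ v → kind v ≡ exploded → ∃[ i ] f i ≡ v) →
  PathwidthAtMost (explodeAll n G f inj) (ℤ.+ 1)
layout⇒pathwidth≤1 zero layout f inj _ only =
  pathwidth≤1 layout λ v kv → contradiction (proj₁ (only v kv)) λ ()
layout⇒pathwidth≤1 (suc n) {G} layout f inj gone-f only =
  layout⇒pathwidth≤1 n (explode-layout layout (f zero) (gone-f zero)) _ _ (gone-f ∘ suc) λ where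
    (inj₁ x) eq → survivors x (only (Survivor.vertex x) eq)
  where
  survivors : ∀ (x : Survivor G (f zero)) → ∃[ i ] f i ≡ Survivor.vertex x →
              ∃[ i ] _≡_ {A = V (explode G (f zero))} (inj₁ (survivor (f (suc i)) _)) (inj₁ x)
  survivors (survivor _ ne) (zero , refl)  = ⊥-elim-irr (ne refl)
  survivors (survivor _ ne) (suc i , refl) = i , refl

-- Cardinalities, vertices that survive explosions, and columns as ordered pairs

length-≤-injection : ∀ {A B : Set} {xs : List A} {ys : List B} (f : A → B) → Unique xs →
  (∀ {x y} → x ∈ xs → y ∈ xs → f x ≡ f y → x ≡ y) → (∀ {x} → x ∈ xs → f x ∈ ys) → length xs ≤ length ys
length-≤-injection {xs = xs} {ys} f xs! f-injective f∈ =
  Fin.injective⇒≤ {f = λ i → Any.index (f∈ (∈-lookup i))} λ {i} {j} eq →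
    lookup-injective xs! i j (f-injective (∈-lookup i) (∈-lookup j)
      (trans (lookup-index (f∈ (∈-lookup i)))
        (trans (cong (List.lookup ys) eq) (sym (lookup-index (f∈ (∈-lookup j)))))))

members : ∀ {b} → Subset b → List (Fin b)
members p = filter (_∈? p) (allFin _)

length-members : ∀ {b} (p : Subset b) → ∣ p ∣ ≡ length (members p)
length-members p = count p p id id id
  where
  -- The induction shortens `p`, while the filter goes on testing membership in the whole subset
  -- `q`; `g` embeds the positions of the remaining part.
  count : ∀ {b c} (p : Subset b) (q : Subset c) (g : Fin b → Fin c) →
          (∀ {i} → i Subset.∈ p → g i Subset.∈ q) → (∀ {i} → g i Subset.∈ q → i Subset.∈ p) →
          ∣ p ∣ ≡ length (filter (_∈? q) (tabulate g))
  count []          q g to from = refl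
  count (true  ∷ p) q g to from with g zero ∈? q
  ... | yes _  = cong suc (count p q (g ∘ suc) (to ∘ there) (drop-there ∘ from))
  ... | no g∉q = contradiction (to here) g∉q
  count (false ∷ p) q g to from with g zero ∈? q
  ... | yes g∈q with () ← from g∈q
  ... | no _    = count p q (g ∘ suc) (to ∘ there) (drop-there ∘ from)

-- A vertex outside the range of `f` passes through each explosion as a survivor. Such vertices keep
-- their mutual adjacencies, which is how the subdivision of the remaining edges is found inside the
-- exploded graph.
survive : ∀ n {G} (f : Fin n → V G) (inj : Injective _≡_ _≡_ f) w → (∀ i → w ≢ f i) →
          V (explodeAll n G f inj)
survive zero        f inj w w≢ = w
survive (suc n) {G} f inj w w≢ =
  survive n {explode G (f zero)} _ _ (inj₁ (survivor w (w≢ zero))) λ i eq → w≢ (suc i) (vertex-≡ G eq)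

survive-injective : ∀ n {G} (f : Fin n → V G) (inj : Injective _≡_ _≡_ f) {w x} w≢ x≢ →
  survive n {G} f inj w w≢ ≡ survive n f inj x x≢ → w ≡ x
survive-injective zero        f inj w≢ x≢ eq = eq
survive-injective (suc n) {G} f inj w≢ x≢ eq = vertex-≡ G (survive-injective n {explode G (f zero)} _ _ _ _ eq)

survive-~ : ∀ n {G} (f : Fin n → V G) (inj : Injective _≡_ _≡_ f) {w x} w≢ x≢ → Graph._~_ G w x →
  Graph._~_ (explodeAll n G f inj) (survive n {G} f inj w w≢) (survive n {G} f inj x x≢)
survive-~ zero        f inj w≢ x≢ w~x = w~x
survive-~ (suc n) {G} f inj w≢ x≢ w~x = survive-~ n {explode G (f zero)} _ _ _ _ w~x

T-∧⁺ : ∀ {x y} → T x → T y → T (x ∧ y)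
T-∧⁺ {x} {y} tx ty = Equivalence.from (T-∧ {x} {y}) (tx , ty)

T-∧⁻ : ∀ {x y} → T (x ∧ y) → T x × T y
T-∧⁻ {x} {y} = Equivalence.to (T-∧ {x} {y})

T-∨⁻ : ∀ {x y} → T (x ∨ y) → T x ⊎ T y
T-∨⁻ {x} {y} = Equivalence.to (T-∨ {x} {y})

T-∨⁺ˡ : ∀ {x y} → T x → T (x ∨ y)
T-∨⁺ˡ {x} {y} tx = Equivalence.from (T-∨ {x} {y}) (inj₁ tx)

T-∨⁺ʳ : ∀ {x y} → T y → T (x ∨ y)
T-∨⁺ʳ {x} {y} ty = Equivalence.from (T-∨ {x} {y}) (inj₂ ty)

T-∧-not⁺ : ∀ {x y} → T x → ¬ T y → T (x ∧ not y)
T-∧-not⁺ {true} {true}  _ ¬t = ¬t _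
T-∧-not⁺ {true} {false} _ _  = _

T-∧-not⁻ : ∀ {x y} → T (x ∧ not y) → T x × ¬ T y
T-∧-not⁻ {true} {false} _ = _ , id

module Columns (n : ℕ) where

  big small : Fin (n * n) → Fin n
  big   e = proj₁ (remQuot {n} n e)
  small e = proj₂ (remQuot {n} n e)

  combine-big-small : ∀ e → combine (big e) (small e) ≡ e
  combine-big-small e = Fin.combine-remQuot {n} n e

  endpoints-injective : ∀ {e e′} → big e ≡ big e′ → small e ≡ small e′ → e ≡ e′
  endpoints-injective {e} {e′} eq eq′ =
    trans (sym (combine-big-small e)) (trans (cong₂ combine eq eq′) (combine-big-small e′))

  flatten : (Fin n → Fin n → Bool) → Subset (n * n)
  flatten M = Vec.tabulate λ e → M (big e) (small e)

  flatten⁻ : ∀ M {e} → e Subset.∈ flatten M → T (M (big e) (small e))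
  flatten⁻ M {e} e∈ = Equivalence.from T-≡ (trans (sym (lookup∘tabulate _ e)) ([]=⇒lookup e∈))

  flatten⁺ : ∀ M {e} → T (M (big e) (small e)) → e Subset.∈ flatten M
  flatten⁺ M {e} t = lookup⇒[]= e _ (trans (lookup∘tabulate _ e) (Equivalence.to T-≡ t))

  incidence⁻ : ∀ (E : EdgeSet n) {x e} → T (incidence E x e) →
    T (has E (big e) (small e)) × (x ≡ big e ⊎ (x ≡ small e × toℕ (small e) < toℕ (big e)))
  incidence⁻ E {x} {e} t with T-∧⁻ {has E (big e) (small e)} t
  ... | edge , t′ with T-∨⁻ {toℕ x ≡ᵇ toℕ (big e)} t′
  ...   | inj₁ eq = edge , inj₁ (Fin.toℕ-injective (≡ᵇ⇒≡ _ _ eq))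
  ...   | inj₂ t″ = let eq , lt = T-∧⁻ {toℕ x ≡ᵇ toℕ (small e)} t″
                    in edge , inj₂ (Fin.toℕ-injective (≡ᵇ⇒≡ _ _ eq) , <ᵇ⇒< _ _ lt)

  incidence-big : ∀ (E : EdgeSet n) {u v} → T (has E u v) → T (incidence E u (combine u v))
  incidence-big E {u} {v} edge = subst (T ∘ incident E u) (sym (Fin.remQuot-combine u v))
    (T-∧⁺ edge (T-∨⁺ˡ (≡⇒≡ᵇ (toℕ u) _ refl)))

  incidence-small : ∀ (E : EdgeSet n) {u v} → T (has E u v) → toℕ v < toℕ u → T (incidence E v (combine u v))
  incidence-small E {u} {v} edge v<u = subst (T ∘ incident E v) (sym (Fin.remQuot-combine u v))
    (T-∧⁺ edge (T-∨⁺ʳ {toℕ v ≡ᵇ toℕ u} (T-∧⁺ (≡⇒≡ᵇ (toℕ v) _ refl) (<⇒<ᵇ v<u))))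

  edge-list⁺ : ∀ (S : EdgeSet n) {u v} → toℕ u < toℕ v → T (has S u v) → (u , v) ∈ edgeList S
  edge-list⁺ S {u} {v} u<v s = ∈-filter⁺ (T? ∘ λ (u , v) → does (u Fin.<? v) ∧ has S u v)
    (∈-cartesianProduct⁺ (∈-allFin u) (∈-allFin v)) (T-∧⁺ (<⇒<ᵇ u<v) s)

  edge-list⁻ : ∀ (S : EdgeSet n) {u v} → (u , v) ∈ edgeList S → toℕ u < toℕ v × T (has S u v)
  edge-list⁻ S {u} {v} uv∈ =
    let lt , s = T-∧⁻ (proj₂ (∈-filter⁻ (T? ∘ λ (u , v) → does (u Fin.<? v) ∧ has S u v)
                                {xs = List.cartesianProduct (allFin n) (allFin n)} uv∈))
    in <ᵇ⇒< _ _ lt , s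

  edge-list-unique : ∀ (S : EdgeSet n) → Unique (edgeList S)
  edge-list-unique S = Unique.filter⁺ (T? ∘ λ (u , v) → does (u Fin.<? v) ∧ has S u v)
    (Unique.cartesianProduct⁺ (Unique.allFin⁺ n) (Unique.allFin⁺ n))

∈-members⁻ : ∀ {b} {p : Subset b} {i} → i ∈ members p → i Subset.∈ p
∈-members⁻ {p = p} i∈ = proj₂ (∈-filter⁻ (_∈? p) {xs = allFin _} i∈)

-- From a set of edges to a set of subdivision vertices

module _ {n} (S : EdgeSet n) where
  open Columns n

  -- The condition keeps one column per edge, the one that subdivides it; taking both orientations
  -- would double the size of the solution.
  picks : Fin n → Fin n → Bool
  picks u v = (toℕ v <ᵇ toℕ u) ∧ has S u v

  chosen : Subset (n * n)
  chosen = flatten picks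

  chosen⁻ : ∀ {e} → e Subset.∈ chosen → toℕ (small e) < toℕ (big e) × T (has S (big e) (small e))
  chosen⁻ {e} e∈ = let lt , s = T-∧⁻ {toℕ (small e) <ᵇ toℕ (big e)} (flatten⁻ picks e∈) in <ᵇ⇒< _ _ lt , s

  chosen⁺ : ∀ {e} → toℕ (small e) < toℕ (big e) → T (has S (big e) (small e)) → e Subset.∈ chosen
  chosen⁺ lt s = flatten⁺ picks (T-∧⁺ (<⇒<ᵇ lt) s)

  ∣chosen∣≤ : ∣ chosen ∣ ≤ ∣ S ∣ₑ
  ∣chosen∣≤ = ≤-trans (≤-reflexive (length-members chosen))
    -- `edgeList` has the smaller endpoint first, a subdividing column the larger one; hence the
    -- swap here and the symmetry of `S` below.
    (length-≤-injection (λ e → small e , big e)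
      (Unique.filter⁺ (_∈? chosen) (Unique.allFin⁺ (n * n)))
      (λ _ _ eq → endpoints-injective (cong proj₂ eq) (cong proj₁ eq))
      λ {e} e∈ → let lt , s = chosen⁻ (∈-members⁻ e∈)
                 in edge-list⁺ S lt (subst T (EdgeSet.has-sym S (big e) (small e)) s))

module _ {n} (E S : EdgeSet n) (S⊆E : S ⊆ₑ E) (arrangement : Arrangement (E ∖ S)) where
  open Graph (graph (E ∖ S)) using (_~_)
  open Columns n
  open Arrangement arrangement

  link-injective : ∀ {p q} → link p ≡ link q → p ≡ q
  link-injective refl = refl

  -- The kind is an index, so that matching on a view reveals it. A link is named after the lower
  -- position of its two ends, which may be the end `u` or the end `v`. `loose` collects the columns
  -- that subdivide no edge of `E`: they are not joined to `v` unless `u` and `v` coincide, so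
  -- position `u` can host them.
  data View (u v : Fin n) : Kind → Set where
    cut        : toℕ v < toℕ u → T (has S u v) → View u v exploded
    ascending  : toℕ v < toℕ u → u ~ v → position v ≡ suc (position u) → View u v (link (position u))
    descending : toℕ v < toℕ u → u ~ v → position u ≡ suc (position v) → View u v (link (position v))
    loose      : (T (has E u v) → ¬ toℕ v < toℕ u) → View u v (pendant (position u))

  view : ∀ u v → ∃[ k ] View u v k
  view u v with toℕ v <? toℕ u | T? (has S u v) | T? (has E u v)
  ... | no v≮u  | _     | _     = _ , loose λ _ → v≮u
  ... | yes v<u | yes s | _     = _ , cut v<u s
  ... | yes v<u | no _  | no ¬e = _ , loose λ e _ → ¬e e
  ... | yes v<u | no ¬s | yes e with position-consecutive (T-∧-not⁺ e ¬s)
  ...   | inj₁ eq = _ , ascending v<u (T-∧-not⁺ e ¬s) eq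
  ...   | inj₂ eq = _ , descending v<u (T-∧-not⁺ e ¬s) eq

  viewAt : ∀ e → View (big e) (small e) (proj₁ (view (big e) (small e)))
  viewAt e = proj₂ (view (big e) (small e))

  chosen⇒exploded : ∀ {u v k} → View u v k → toℕ v < toℕ u → T (has S u v) → k ≡ exploded
  chosen⇒exploded (cut _ _)            v<u s = refl
  chosen⇒exploded (ascending _ u~v _)  v<u s = contradiction s (proj₂ (T-∧-not⁻ u~v))
  chosen⇒exploded (descending _ u~v _) v<u s = contradiction s (proj₂ (T-∧-not⁻ u~v))
  chosen⇒exploded (loose ¬edge)        v<u s = contradiction v<u (¬edge (S⊆E _ _ s))

  exploded⇒chosen : ∀ {u v k} → View u v k → k ≡ exploded → toℕ v < toℕ u × T (has S u v)
  exploded⇒chosen (cut v<u s) _ = v<u , s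

  -- The ends of `link p` are the vertices at positions `p` and `suc p`, which injectivity of
  -- `position` determines. If one view is ascending and the other descending, the same two ends
  -- appear in opposite order, against `v < u` in both.
  link-endpoints : ∀ {u v u′ v′ k k′ p} → View u v k → View u′ v′ k′ → k ≡ link p → k′ ≡ link p →
                   u ≡ u′ × v ≡ v′
  link-endpoints (ascending _ _ eq) (ascending _ _ eq′) refl refl′ =
    meet₁ , position-injective (trans eq (trans (cong (suc ∘ position) meet₁) (sym eq′)))
    where meet₁ = position-injective (sym (link-injective refl′))
  link-endpoints (descending _ _ eq) (descending _ _ eq′) refl refl′ =
    position-injective (trans eq (trans (cong (suc ∘ position) meet₁) (sym eq′))) , meet₁
    where meet₁ = position-injective (sym (link-injective refl′))
  link-endpoints (ascending v<u _ eq) (descending v′<u′ _ eq′) refl refl′ =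
    contradiction v<u (<-asym (subst₂ (λ a b → toℕ a < toℕ b) u≡ v≡ v′<u′))
    where
    u≡ = position-injective (link-injective refl′)
    v≡ = position-injective (trans eq′ (trans (cong (suc ∘ position) u≡) (sym eq)))
  link-endpoints (descending v<u _ eq) (ascending v′<u′ _ eq′) refl refl′ =
    contradiction v<u (<-asym (subst₂ (λ a b → toℕ a < toℕ b) u≡ v≡ v′<u′))
    where
    v≡ = position-injective (link-injective refl′)
    u≡ = position-injective (trans eq′ (trans (cong (suc ∘ position) v≡) (sym eq)))

  view-within : ∀ {u v k} → View u v k → reach k < extent
  view-within {u}     (cut _ _)           = ≤-<-trans z≤n (position<extent u)
  view-within {v = v} (ascending _ _ eq)  = subst (_< extent) eq (position<extent v)
  view-within {u}     (descending _ _ eq) = subst (_< extent) eq (position<extent u)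
  view-within {u}     (loose _)           = position<extent u

  view-attached : ∀ {x u v k} → View u v k → T (has E u v) → x ≡ u ⊎ (x ≡ v × toℕ v < toℕ u) →
                  Attached (position x) k
  view-attached (cut _ _)           _ _                   = gone
  view-attached (ascending _ _ _)   _ (inj₁ refl)         = left
  view-attached {u = u} (ascending _ _ eq) _ (inj₂ (refl , _)) = subst (λ p → Attached p (link (position u))) (sym eq) right
  view-attached {v = v} (descending _ _ eq) _ (inj₁ refl) = subst (λ p → Attached p (link (position v))) (sym eq) right
  view-attached (descending _ _ _)  _ (inj₂ (refl , _))   = left
  view-attached (loose _)           _ (inj₁ refl)         = leaf
  view-attached (loose ¬edge)       e (inj₂ (refl , v<u)) = contradiction v<u (¬edge e)

  kindOf : Fin n ⊎ Fin (n * n) → Kind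
  kindOf (inj₁ u) = top (position u)
  kindOf (inj₂ e) = proj₁ (view (big e) (small e))

  subdivision-layout : Layout (bipartite (subdivision E)) extent
  subdivision-layout = record
    { vertices       = map inj₁ (allFin n) ++ map inj₂ (allFin (n * n))
    ; complete       = λ where
        (inj₁ u) → ∈-++⁺ˡ (∈-map⁺ inj₁ (∈-allFin u))
        (inj₂ e) → ∈-++⁺ʳ (map inj₁ (allFin n)) (∈-map⁺ inj₂ (∈-allFin e))
    ; _≟_            = Sum.≡-dec Fin._≟_ Fin._≟_
    ; _~?_           = λ where
        (inj₁ _) (inj₁ _) → no λ ()
        (inj₁ x) (inj₂ e) → T? (incidence E x e)
        (inj₂ e) (inj₁ x) → T? (incidence E x e)
        (inj₂ _) (inj₂ _) → no λ ()
    ; kind           = kindOf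
    ; within         = λ where
        (inj₁ u) → position<extent u
        (inj₂ e) → view-within (viewAt e)
    ; top-injective  = top-unique
    ; link-injective = link-unique
    ; edge           = λ {x} {y} → edge′ x y
    }
    where
    attach : ∀ {x e} → T (incidence E x e) → Attached (position x) (kindOf (inj₂ e))
    attach {e = e} t = let edge , x∈ = incidence⁻ E t in view-attached (viewAt e) edge x∈

    edge′ : ∀ x y → BipartiteAdj (subdivision E) x y →
            (∃[ p ] (kindOf x ≡ top p × Attached p (kindOf y))) ⊎
            (∃[ p ] (kindOf y ≡ top p × Attached p (kindOf x)))
    edge′ (inj₁ x) (inj₂ e) t = inj₁ (position x , refl , attach t)
    edge′ (inj₂ e) (inj₁ x) t = inj₂ (position x , refl , attach t)

    no-top : ∀ {u v k p} → View u v k → k ≢ top p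
    no-top (cut _ _) ()

    top-unique : ∀ {x y p} → kindOf x ≡ top p → kindOf y ≡ top p → x ≡ y
    top-unique {inj₁ u} {inj₁ v} refl eq′ = cong inj₁ (position-injective (sym (top-injective′ eq′)))
      where
      top-injective′ : ∀ {p q} → top p ≡ top q → p ≡ q
      top-injective′ refl = refl
    top-unique {inj₂ e} eq _ = contradiction eq (no-top (viewAt e))
    top-unique {inj₁ _} {inj₂ e} _ eq = contradiction eq (no-top (viewAt e))

    link-unique : ∀ {x y p} → kindOf x ≡ link p → kindOf y ≡ link p → x ≡ y
    link-unique {inj₂ e} {inj₂ e′} eq eq′ =
      let bigs , smalls = link-endpoints (viewAt e) (viewAt e′) eq eq′
      in cong inj₂ (endpoints-injective bigs smalls)

  explodeSet-pathwidth≤1 : PathwidthAtMost (explodeSet (subdivision E) (chosen S)) (ℤ.+ 1)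
  explodeSet-pathwidth≤1 = layout⇒pathwidth≤1 _ subdivision-layout _ _
    (λ i → let lt , s = chosen⁻ S (∈-members⁻ {p = chosen S} (∈-lookup {xs = members (chosen S)} i))
           in chosen⇒exploded (viewAt (List.lookup (members (chosen S)) i)) lt s)
    λ where
      (inj₂ e) eq → let lt , s = exploded⇒chosen (viewAt e) eq
                        e∈ = ∈-filter⁺ (_∈? chosen S) (∈-allFin e) (chosen⁺ S lt s)
                    in Any.index e∈ , cong inj₂ (sym (lookup-index e∈))

-- From a set of subdivision vertices to a set of edges

module _ {n} (E : EdgeSet n) (p : Subset (n * n)) where
  open Columns n

  -- For u < v the vertex combine u v is not the subdivision vertex of uv.
  selects : Fin n → Fin n → Bool
  selects u v = (toℕ v <ᵇ toℕ u) ∧ Vec.lookup p (combine u v)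

  selects⁻ : ∀ {u v} → T (selects u v) → toℕ v < toℕ u × combine u v Subset.∈ p
  selects⁻ {u} {v} t = let lt , l = T-∧⁻ {toℕ v <ᵇ toℕ u} t
                       in <ᵇ⇒< _ _ lt , lookup⇒[]= (combine u v) p (Equivalence.to T-≡ l)

  selects⁺ : ∀ {u v} → toℕ v < toℕ u → combine u v Subset.∈ p → T (selects u v)
  selects⁺ lt uv∈ = T-∧⁺ (<⇒<ᵇ lt) (Equivalence.from T-≡ ([]=⇒lookup uv∈))

  selected : EdgeSet n
  selected = record
    { has        = λ u v → has E u v ∧ (selects u v ∨ selects v u)
    ; has-sym    = λ u v → cong₂ _∧_ (EdgeSet.has-sym E u v) (∨-comm (selects u v) (selects v u))
    ; has-irrefl = λ v → cong (_∧ (selects v v ∨ selects v v)) (EdgeSet.has-irrefl E v)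
    }

  selected⁻ : ∀ {u v} → T (has selected u v) →
    (toℕ v < toℕ u × combine u v Subset.∈ p) ⊎ (toℕ u < toℕ v × combine v u Subset.∈ p)
  selected⁻ {u} {v} t with T-∨⁻ {selects u v} (proj₂ (T-∧⁻ {has E u v} t))
  ... | inj₁ s = inj₁ (selects⁻ s)
  ... | inj₂ s = inj₂ (selects⁻ s)

  selected⊆ : selected ⊆ₑ E
  selected⊆ u v t = proj₁ (T-∧⁻ {has E u v} t)

  ∣selected∣≤ : ∣ selected ∣ₑ ≤ ∣ p ∣
  ∣selected∣≤ = ≤-trans (length-≤-injection (λ (u , v) → combine v u) (edge-list-unique selected) injective member)
    (≤-reflexive (sym (length-members p)))
    where
    injective : ∀ {x y : Fin n × Fin n} → x ∈ edgeList selected → y ∈ edgeList selected →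
                combine (proj₂ x) (proj₁ x) ≡ combine (proj₂ y) (proj₁ y) → x ≡ y
    injective {u , v} {u′ , v′} _ _ eq =
      let v≡ , u≡ = Fin.combine-injective v u v′ u′ eq in cong₂ _,_ u≡ v≡
    member : ∀ {x : Fin n × Fin n} → x ∈ edgeList selected → combine (proj₂ x) (proj₁ x) ∈ members p
    member {u , v} uv∈ with edge-list⁻ selected uv∈
    ... | u<v , s with selected⁻ s
    ...   | inj₁ (v<u , _) = contradiction v<u (<-asym u<v)
    ...   | inj₂ (_ , ∈p)  = ∈-filter⁺ (_∈? p) (∈-allFin (combine v u)) ∈p

  open Graph (graph (E ∖ selected)) using (_~_; ~-sym; ~-irrefl)

  -- With the larger endpoint first, this is the column joined to both ends of an edge,
  -- independently of the order in which the ends are given.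
  column : Fin n → Fin n → Fin (n * n)
  column u v with toℕ v <? toℕ u
  ... | yes _ = combine u v
  ... | no _  = combine v u

  column-injective : ∀ u v w → column u v ≡ column u w → v ≡ w
  column-injective u v w eq with toℕ v <? toℕ u | toℕ w <? toℕ u
  ... | yes _ | yes _ = proj₂ (Fin.combine-injective u v u w eq)
  ... | no _  | no _  = proj₁ (Fin.combine-injective v u w u eq)
  ... | yes _ | no _  = let u≡w , v≡u = Fin.combine-injective u v w u eq in trans v≡u u≡w
  ... | no _  | yes _ = let v≡u , u≡w = Fin.combine-injective v u u w eq in trans v≡u u≡w

  column-left : ∀ {u v} → u ~ v → T (incidence E u (column u v))
  column-left {u} {v} u~v with toℕ v <? toℕ u
  ... | yes v<u = incidence-big E (proj₁ (T-∧-not⁻ u~v))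
  ... | no v≮u  = incidence-small E (proj₁ (T-∧-not⁻ (~-sym u~v))) (≤∧≢⇒< (≮⇒≥ v≮u) (u≢v ∘ Fin.toℕ-injective))
    where
    u≢v : u ≢ v
    u≢v refl = ~-irrefl {u} u~v

  column-right : ∀ {u v} → u ~ v → T (incidence E v (column u v))
  column-right {u} {v} u~v with toℕ v <? toℕ u
  ... | yes v<u = incidence-small E (proj₁ (T-∧-not⁻ u~v)) v<u
  ... | no v≮u  = incidence-big E (proj₁ (T-∧-not⁻ (~-sym u~v)))

  unselected : ∀ {u v} → u ~ v → ¬ T (selects u v ∨ selects v u)
  unselected {u} {v} u~v t = let e , ¬s = T-∧-not⁻ {has E u v} u~v in ¬s (T-∧⁺ {has E u v} e t)

  column∉ : ∀ {u v} → u ~ v → ¬ column u v Subset.∈ p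
  column∉ {u} {v} u~v uv∈ with toℕ v <? toℕ u
  ... | yes v<u = unselected u~v (T-∨⁺ˡ {selects u v} {selects v u} (selects⁺ v<u uv∈))
  ... | no v≮u  = unselected u~v (T-∨⁺ʳ {selects u v} {selects v u}
                    (selects⁺ (≤∧≢⇒< (≮⇒≥ v≮u) (u≢v ∘ Fin.toℕ-injective)) uv∈))
    where
    u≢v : u ≢ v
    u≢v refl = ~-irrefl {u} u~v

  -- If the column of a remaining edge belonged to `p`, that edge would have been selected. So every
  -- midpoint survives, and the corners survive because only columns are exploded.
  subdivision-survives : SubdivisionIn (E ∖ selected) (explodeSet (subdivision E) p)
  subdivision-survives = record
    { corner             = λ u → survive′ (inj₁ u) (λ _ ())
    ; midpoint           = λ {u} {v} u~v → survive′ (inj₂ (column u v)) (column≢ u~v)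
    ; corner-injective   = λ eq → Sum.inj₁-injective (survive-injective _ {G} f _ _ _ eq)
    ; midpoint≢corner    = λ e w eq → contradiction (survive-injective _ {G} f _ _ _ eq) λ ()
    ; midpoint-injective = λ {u} {v} {w} e f′ eq →
        column-injective u v w (Sum.inj₂-injective (survive-injective _ {G} f _ _ _ eq))
    ; left               = λ e → survive-~ _ {G} f _ _ _ (column-left e)
    ; right              = λ e → survive-~ _ {G} f _ _ _ (column-right e)
    }
    where
    G = bipartite (subdivision E)
    f : Fin (length (members p)) → V G
    f = inj₂ ∘ List.lookup (members p)
    survive′ : ∀ w → (∀ i → w ≢ f i) → V (explodeSet (subdivision E) p)
    survive′ w w≢ = survive (length (members p)) {G} f _ w w≢
    column≢ : ∀ {u v} → u ~ v → ∀ i → inj₂ (column u v) ≢ f i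
    column≢ u~v i eq = column∉ u~v (subst (Subset._∈ p) (sym (Sum.inj₂-injective eq)) (∈-members⁻ (∈-lookup i)))

  explodeSet⇒linearForest : PathwidthAtMost (explodeSet (subdivision E) p) (ℤ.+ 1) → LinearForest (graph (E ∖ selected))
  explodeSet⇒linearForest = pathwidth≤1⇒linearForest subdivision-survives

-- Restricted solutions and the two reductions

chosen⊆ : ∀ {n} (S X : EdgeSet n) → S ⊆ₑ X → chosen S Subset.⊆ Columns.flatten n (has X)
chosen⊆ S X S⊆X {e} e∈ = Columns.flatten⁺ _ (has X) (S⊆X _ _ (proj₂ (chosen⁻ S e∈)))

module _ {n} (E : EdgeSet n) where
  open Columns n

  flatten-combine⁻ : ∀ M {u v} → combine u v Subset.∈ flatten M → T (M u v)
  flatten-combine⁻ M {u} {v} uv∈ = subst (T ∘ uncurry M) (Fin.remQuot-combine u v) (flatten⁻ M uv∈)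

  selected⊆ₑ : ∀ p X → p Subset.⊆ flatten (has X) → selected E p ⊆ₑ X
  selected⊆ₑ p X p⊆X u v t with selected⁻ E p {u} {v} t
  ... | inj₁ (_ , uv∈) = flatten-combine⁻ (has X) (p⊆X uv∈)
  ... | inj₂ (_ , vu∈) = subst T (EdgeSet.has-sym X v u) (flatten-combine⁻ (has X) (p⊆X vu∈))

toList-flatten : ∀ {n} (M : Fin n → Fin n → Bool) → Vec.toList (Columns.flatten n M) ≡ matrix M
toList-flatten {n} M = trans (toList-tabulate {n = n * n} _) (sym (matrix-flat M))
  where
  toList-tabulate : ∀ {n} (f : Fin n → Bool) → Vec.toList (Vec.tabulate f) ≡ List.tabulate f
  toList-tabulate {zero}  f = refl
  toList-tabulate {suc n} f = cong (f zero ∷_) (toList-tabulate (f ∘ suc))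

lemma3 : ParameterPreservingReduction CPS BOVE × ParameterPreservingReduction RestrictedCPS RestrictedBOVE
lemma3 = record
  { reduce         = λ (G , k) → subdivision (FiniteGraph.edges G) , k
  ; polynomialTime = expansion-polynomialTime (FiniteGraph.order ∘ proj₁) (FiniteGraph.edges ∘ proj₁)
      (binary ∘ proj₂)
      (λ (G , k) → ++-assoc (unary (FiniteGraph.order G)) (matrix (has (FiniteGraph.edges G))) (binary k))
      (λ _ → refl)
  ; parameter      = λ _ _ → ≤-refl
  ; correct        = λ G k → let E = FiniteGraph.edges G in mk⇔
      (λ (S , S⊆E , ∣S∣≤k , forest) → chosen S , ≤-trans (∣chosen∣≤ S) ∣S∣≤k ,
        explodeSet-pathwidth≤1 E S S⊆E (linearForest⇒arrangement forest))
      (λ (p , ∣p∣≤k , pw) → selected E p , selected⊆ E p , ≤-trans (∣selected∣≤ E p) ∣p∣≤k ,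
        explodeSet⇒linearForest E p pw)
  } , record
  { reduce         = λ ((G , X , _) , k) →
      (subdivision (FiniteGraph.edges G) , Columns.flatten _ (has X)) , k
  ; polynomialTime = expansion-polynomialTime (FiniteGraph.order ∘ proj₁ ∘ proj₁) (FiniteGraph.edges ∘ proj₁ ∘ proj₁)
      -- The copied remainder of the input here consists of the matrix of `X` followed by `k`; by
      -- `toList-flatten` that matrix is already the code of the set of columns.
      (λ ((G , X , _) , k) → matrix (has X) ++ binary k)
      (λ ((G , X , _) , k) →
        trans (++-assoc (codeGraph G) (matrix (has X)) (binary k))
              (++-assoc (unary (FiniteGraph.order G)) (matrix (has (FiniteGraph.edges G))) _))
      (λ ((G , X , _) , k) → let H = subdivision (FiniteGraph.edges G) in
        trans (++-assoc (codeBipartite H) (Vec.toList (Columns.flatten _ (has X))) (binary k))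
              (cong (λ bits → codeBipartite H ++ bits ++ binary k) (toList-flatten (has X))))
  ; parameter      = λ _ _ → ≤-refl
  ; correct        = λ (G , X , X⊆E) k → let E = FiniteGraph.edges G in mk⇔
      (λ (S , S⊆X , ∣S∣≤k , forest) → let S⊆E = λ u v → X⊆E u v ∘ S⊆X u v in
        chosen S , chosen⊆ S X S⊆X , ≤-trans (∣chosen∣≤ S) ∣S∣≤k ,
        explodeSet-pathwidth≤1 E S S⊆E (linearForest⇒arrangement forest))
      (λ (p , p⊆X , ∣p∣≤k , pw) → selected E p , selected⊆ₑ E p X p⊆X , ≤-trans (∣selected∣≤ E p) ∣p∣≤k ,
        explodeSet⇒linearForest E p pw)
  }
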